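{- Let $K$ be a non-Archimedean locally compact field of characteristic $p>0$, and let $U=1+M_K$ be its group of 1-units. Let $\Lambda$ be the set of maps $f:U\to U$ that are locally analytic on $U$ and satisfy $f(uv)=f(u)f(v)$ for all $u,v\in U$; it is a group under pointwise multiplication. Then the map $(\mathbb{Z}_p,+)\to(\Lambda,\cdot)$, $y\mapsto (u\mapsto u^y)$, is an isomorphism of groups. In particular $(\Lambda,\cdot)\cong(\mathbb{Z}_p,+)$.
   Context: $K$ has ring of integers $R_K$ with maximal ideal $M_K$, constant field $\mathbb{F}$ of order $q$, and a uniformizer $\pi$, so $K=\mathbb{F}((\pi))$ and $U=1+\pi\mathbb{F}[[\pi]]$. The absolute value is $|x|=q^{ -v(x)}$. For $\alpha\in R_K$ and $t>0$, $B_{\alpha,t}=\{u\in R_K: |u-\alpha|\le t\}$. A continuous function $f$ on a ball $B_{\alpha,t}$ with $t=|\rho|$ ($\rho\in R_K$) is analytic there if $f(u)=\sum_{n\ge0}c_n\left(\frac{u-\alpha}{\rho}\right)^n$ with $c_n\in K$, $c_n\to0$. A continuous function $f:U\to K$ is locally analytic if every $\alpha\in U$ has a ball $B_{\alpha,t_\alpha}\subset U$ ($t_\alpha>0$) on which $f$ is analytic. For $y\in\mathbb{Z}_p$ and $u=1+x\in U$, $u^y=\sum_{n\ge0}\binom{y}{n}x^n$ (the natural $\mathbb{Z}_p$-module structure on $U$). -}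

module Defs where

open import Level using (Level; _⊔_) renaming (suc to lsuc)
open import Algebra.Bundles using (CommutativeRing; Semiring)
open import Algebra.Bundles.Raw using (RawRing; RawGroup)
open import Algebra.Core using (Op₁; Op₂)
open import Algebra.Structures using (IsGroup)
import Algebra.Definitions.RawSemiring as RawSemiringDefinitions
open import Data.Fin.Base using (Fin; toℕ)
open import Data.Integer.Base as ℤ using (ℤ; +_; -[1+_])
import Data.Integer.Properties as ℤ
open import Data.Integer.Divisibility.Signed using (divides; ∣ᵤ⇒∣; ∣⇒∣ᵤ; ∣m∣n⇒∣m+n; ∣m∣n⇒∣m-n; ∣m⇒∣-m) renaming (_∣_ to _∣ᶻ_; ∣-trans to ∣ᶻ-trans)
open import Data.Integer.DivMod using (_%ℕ_; _/ℕ_; a≡a%ℕn+[a/ℕn]*n)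
import Data.Integer.Solver as ℤSolver
open import Data.Nat.Base as ℕ using (ℕ; zero; suc; NonZero; s≤s)
import Data.Nat.Properties as ℕ
open import Data.Nat.Combinatorics using (_C_; nCk+nC[k+1]≡[n+1]C[k+1]; k>n⇒nCk≡0; nC1≡n)
open import Data.Nat.Divisibility using (_∣_; divides; _∣?_; divides-refl; 1∣_; ∣-trans; m∣m*n; n∣m*n; *-cancelˡ-∣; *-pres-∣; ∣-refl)
open import Data.Nat.Primality using (Prime; euclidsLemma; prime⇒nonZero; prime⇒nonTrivial)
open import Data.Nat.Solver using (module +-*-Solver)
open import Data.Product.Base using (∃-syntax; _×_)
open import Data.Sum.Base using (inj₁; inj₂)
open import Function.Bundles using (Func; Inverse)
open import Relation.Binary.Bundles using (Setoid)
open import Relation.Binary.PropositionalEquality as ≡ using (_≡_; refl; cong; cong₂; subst; module ≡-Reasoning)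
open import Relation.Nullary using (¬_; yes; no; contradiction)

-- p is prime wherever this is used, so the last field says that the
-- characteristic is p.
record FiniteField (c ℓ : Level) (p : ℕ) : Set (lsuc (c ⊔ ℓ)) where
  field
    commutativeRing : CommutativeRing c ℓ
  open CommutativeRing commutativeRing public
  open RawSemiringDefinitions (Semiring.rawSemiring semiring) public using (sum) renaming (_×_ to _×ꟳ_)
  field
    0≉1            : ¬ (0# ≈ 1#)
    inverse        : ∀ x → ¬ (x ≈ 0#) → ∃[ y ] x * y ≈ 1#
    q              : ℕ
    enumeration    : Inverse setoid (≡.setoid (Fin q))
    characteristic : p ×ꟳ 1# ≈ 0#

absorption : ∀ n k → suc k ℕ.* (suc n C suc k) ≡ suc n ℕ.* (n C k)
absorption zero    zero    = refl
absorption zero    (suc k) = begin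
  suc (suc k) ℕ.* (1 C suc (suc k)) ≡⟨ cong (suc (suc k) ℕ.*_) (k>n⇒nCk≡0 {1} {suc (suc k)} (s≤s (s≤s ℕ.z≤n))) ⟩
  suc (suc k) ℕ.* 0                 ≡⟨ ℕ.*-zeroʳ (suc (suc k)) ⟩
  0                                 ≡⟨ cong (1 ℕ.*_) (k>n⇒nCk≡0 {0} {suc k} (s≤s ℕ.z≤n)) ⟨
  1 ℕ.* (0 C suc k)                 ∎
  where open ≡-Reasoning
absorption (suc n) zero    = begin
  1 ℕ.* (suc (suc n) C 1) ≡⟨ cong (1 ℕ.*_) (nC1≡n (suc (suc n))) ⟩
  1 ℕ.* suc (suc n)       ≡⟨ ℕ.*-comm 1 (suc (suc n)) ⟩
  suc (suc n) ℕ.* 1       ∎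
  where open ≡-Reasoning
absorption (suc n) (suc k) = begin
  suc (suc k) ℕ.* (suc (suc n) C suc (suc k))
    ≡⟨ cong (suc (suc k) ℕ.*_) (nCk+nC[k+1]≡[n+1]C[k+1] (suc n) (suc k)) ⟨
  suc (suc k) ℕ.* (A ℕ.+ B)
    ≡⟨ ℕ.*-distribˡ-+ (suc (suc k)) A B ⟩
  (A ℕ.+ suc k ℕ.* A) ℕ.+ suc (suc k) ℕ.* B
    ≡⟨ cong₂ (λ x y → (A ℕ.+ x) ℕ.+ y) (absorption n k) (absorption n (suc k)) ⟩
  (A ℕ.+ suc n ℕ.* (n C k)) ℕ.+ suc n ℕ.* (n C suc k)
    ≡⟨ ℕ.+-assoc A _ _ ⟩
  A ℕ.+ (suc n ℕ.* (n C k) ℕ.+ suc n ℕ.* (n C suc k))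
    ≡⟨ cong (A ℕ.+_) (ℕ.*-distribˡ-+ (suc n) (n C k) (n C suc k)) ⟨
  A ℕ.+ suc n ℕ.* ((n C k) ℕ.+ (n C suc k))
    ≡⟨ cong (λ x → A ℕ.+ suc n ℕ.* x) (nCk+nC[k+1]≡[n+1]C[k+1] n k) ⟩
  suc (suc n) ℕ.* A ∎
  where
  open ≡-Reasoning
  A = suc n C suc k
  B = suc n C suc (suc k)

≤⇒^∣^ : ∀ p {a b} → a ℕ.≤ b → p ℕ.^ a ∣ p ℕ.^ b
≤⇒^∣^ p {a} {b} a≤b = subst (p ℕ.^ a ∣_)
  (≡.trans (≡.sym (ℕ.^-distribˡ-+-* p a (b ℕ.∸ a))) (cong (p ℕ.^_) (ℕ.m+[n∸m]≡n a≤b)))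
  (m∣m*n (p ℕ.^ (b ℕ.∸ a)))

-- The p-adic integers as lim ℤ/pⁿ: `approx n` represents the component in
-- ℤ/pⁿ, so only its class modulo pⁿ is significant.
record ℤₚ (p : ℕ) : Set where
  field
    approx   : ℕ → ℤ
    coherent : ∀ n → + (p ℕ.^ n) ∣ᶻ approx (suc n) ℤ.- approx n

open ℤₚ public

module _ {p : ℕ} where

  infix  4 _≈ₚ_
  infixl 6 _+ₚ_

  _≈ₚ_ : ℤₚ p → ℤₚ p → Set
  x ≈ₚ y = ∀ n → + (p ℕ.^ n) ∣ᶻ approx x n ℤ.- approx y n

  _+ₚ_ : ℤₚ p → ℤₚ p → ℤₚ p
  approx   (x +ₚ y) n = approx x n ℤ.+ approx y n
  coherent (x +ₚ y) n = subst (+ (p ℕ.^ n) ∣ᶻ_)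
    (solve 4 (λ a b c d → (a :- b) :+ (c :- d) := (a :+ c) :- (b :+ d)) refl
       (approx x (suc n)) (approx x n) (approx y (suc n)) (approx y n))
    (∣m∣n⇒∣m+n (coherent x n) (coherent y n))
    where open ℤSolver.+-*-Solver

  -ₚ_ : ℤₚ p → ℤₚ p
  approx   (-ₚ x) n = ℤ.- approx x n
  coherent (-ₚ x) n = subst (+ (p ℕ.^ n) ∣ᶻ_)
    (solve 2 (λ a b → :- (a :- b) := (:- a) :- (:- b)) refl (approx x (suc n)) (approx x n))
    (∣m⇒∣-m (coherent x n))
    where open ℤSolver.+-*-Solver

  0ₚ : ℤₚ p
  approx   0ₚ _ = + 0
  coherent 0ₚ _ = divides (+ 0) refl

ℤₚ-rawGroup : ℕ → RawGroup _ _
ℤₚ-rawGroup p = record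
  { Carrier = ℤₚ p ; _≈_ = _≈ₚ_ ; _∙_ = _+ₚ_ ; ε = 0ₚ ; _⁻¹ = -ₚ_ }

module Binomial {p : ℕ} (p-prime : Prime p) where

  private
    instance
      p≢0 : NonZero p
      p≢0 = prime⇒nonZero p-prime

    p^≢0 : ∀ k → NonZero (p ℕ.^ k)
    p^≢0 k = ℕ.m^n≢0 p k

  residue : ℤₚ p → ℕ → ℕ
  residue y k = (approx y k %ℕ (p ℕ.^ k)) {{p^≢0 k}}

  p∤j⇒ : ∀ k {j c} → ¬ (p ∣ j) → p ℕ.^ k ∣ j ℕ.* c → p ℕ.^ k ∣ c
  p∤j⇒ zero    _   _ = 1∣ _
  p∤j⇒ (suc k) {j} {c} p∤j d
    with euclidsLemma j c p-prime (∣-trans (m∣m*n (p ℕ.^ k)) d)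
  ... | inj₁ p∣j = contradiction p∣j p∤j
  ... | inj₂ (divides-refl c′) = subst (p ℕ.^ suc k ∣_) (ℕ.*-comm p c′)
    (*-pres-∣ (∣-refl {p}) (p∤j⇒ k p∤j (*-cancelˡ-∣ p (subst (p ℕ.* p ℕ.^ k ∣_)
      (solve 3 (λ j c p → j :* (c :* p) := p :* (j :* c)) refl j c′ p) d))))
    where open +-*-Solver

  cancel : ∀ fuel k j .{{_ : NonZero j}} {c} → j ℕ.≤ fuel → p ℕ.^ (k ℕ.+ j) ∣ j ℕ.* c → p ℕ.^ k ∣ c
  cancel zero       k (suc j) () d
  cancel (suc fuel) k j@(suc j-1) {c} j≤ d with p ∣? j
  ... | no p∤j = p∤j⇒ k {j} p∤j (∣-trans (≤⇒^∣^ p (ℕ.m≤m+n k j)) d)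
  ... | yes (divides j′@(suc _) j≡j′p) = cancel fuel k j′ j′≤fuel
          (∣-trans (≤⇒^∣^ p (ℕ.+-monoʳ-≤ k j′≤j-1))
            (*-cancelˡ-∣ p (subst₂′ (cong (p ℕ.^_) (ℕ.+-suc k j-1)) eq d)))
    where
    open +-*-Solver
    subst₂′ : ∀ {a b c d} → a ≡ b → c ≡ d → a ∣ c → b ∣ d
    subst₂′ refl refl x = x
    eq : j ℕ.* c ≡ p ℕ.* (j′ ℕ.* c)
    eq = ≡.trans (cong (ℕ._* c) j≡j′p)
      (solve 3 (λ j p c → (j :* p) :* c := p :* (j :* c)) refl j′ p c)
    j′<j : j′ ℕ.< j
    j′<j = subst (j′ ℕ.<_) (≡.sym j≡j′p)
      (ℕ.m<m*n j′ p (ℕ.nonTrivial⇒n>1 p {{prime⇒nonTrivial p-prime}}))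
    j′≤j-1 : j′ ℕ.≤ j-1
    j′≤j-1 = ℕ.≤-pred j′<j
    j′≤fuel : j′ ℕ.≤ fuel
    j′≤fuel = ℕ.≤-trans j′≤j-1 (ℕ.≤-pred j≤)

  -- If a ≡ b modulo p^(k+n) then C(a,n) ≡ C(b,n) modulo p^k.
  C-cong : ∀ n a m k → p ℕ.^ (k ℕ.+ n) ∣ m →
           + (p ℕ.^ k) ∣ᶻ + ((a ℕ.+ m) C n) ℤ.- + (a C n)
  C-cong zero    a       m       k d = divides (+ 0) refl
  C-cong (suc n) zero    zero    k d = divides (+ 0) (ℤ.+-inverseʳ (+ (0 C suc n)))
  C-cong (suc n) zero    (suc m) k d =
    subst (+ (p ℕ.^ k) ∣ᶻ_)
      (≡.trans (≡.sym (ℤ.+-identityʳ (+ (suc m C suc n))))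
        (cong (λ z → + (suc m C suc n) ℤ.- + z) (≡.sym (k>n⇒nCk≡0 {0} {suc n} (s≤s ℕ.z≤n)))))
      (∣ᵤ⇒∣ (cancel (suc n) k (suc n) ℕ.≤-refl
        (subst (p ℕ.^ (k ℕ.+ suc n) ∣_) (≡.sym (absorption m n))
          (∣-trans d (m∣m*n (m C n))))))
  C-cong (suc n) (suc a) m       k d =
    subst (+ (p ℕ.^ k) ∣ᶻ_) eq
      (∣m∣n⇒∣m+n (C-cong n a m k (∣-trans (≤⇒^∣^ p (ℕ.+-monoʳ-≤ k (ℕ.n≤1+n n))) d))
                 (C-cong (suc n) a m k d))
    where
    open ≡-Reasoning
    w = (a ℕ.+ m) C n
    x = a C n
    y = (a ℕ.+ m) C suc n
    z = a C suc n
    eq : (+ w ℤ.- + x) ℤ.+ (+ y ℤ.- + z)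
       ≡ + (suc (a ℕ.+ m) C suc n) ℤ.- + (suc a C suc n)
    eq = begin
      (+ w ℤ.- + x) ℤ.+ (+ y ℤ.- + z)
        ≡⟨ solve 4 (λ w x y z → (w :- x) :+ (y :- z) := (w :+ y) :- (x :+ z)) refl (+ w) (+ x) (+ y) (+ z) ⟩
      + (w ℕ.+ y) ℤ.- + (x ℕ.+ z)
        ≡⟨ cong₂ (λ s t → + s ℤ.- + t) (nCk+nC[k+1]≡[n+1]C[k+1] (a ℕ.+ m) n) (nCk+nC[k+1]≡[n+1]C[k+1] a n) ⟩
      + (suc (a ℕ.+ m) C suc n) ℤ.- + (suc a C suc n) ∎
      where open ℤSolver.+-*-Solver

  C-cong′ : ∀ n a b k → + (p ℕ.^ (k ℕ.+ n)) ∣ᶻ + b ℤ.- + a →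
            + (p ℕ.^ k) ∣ᶻ + (b C n) ℤ.- + (a C n)
  C-cong′ n a b k d with ℕ.≤-total a b
  ... | inj₁ a≤b = subst (λ t → + (p ℕ.^ k) ∣ᶻ + (t C n) ℤ.- + (a C n)) (ℕ.m+[n∸m]≡n a≤b)
        (C-cong n a (b ℕ.∸ a) k (subst (λ t → p ℕ.^ (k ℕ.+ n) ∣ ℤ.∣ t ∣)
          (≡.trans (ℤ.m-n≡m⊖n b a) (ℤ.⊖-≥ a≤b)) (∣⇒∣ᵤ d)))
  ... | inj₂ b≤a = subst (+ (p ℕ.^ k) ∣ᶻ_) (neg-sub (+ (a C n)) (+ (b C n)))
        (∣m⇒∣-m (subst (λ t → + (p ℕ.^ k) ∣ᶻ + (t C n) ℤ.- + (b C n)) (ℕ.m+[n∸m]≡n b≤a)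
          (C-cong n b (a ℕ.∸ b) k (subst (λ t → p ℕ.^ (k ℕ.+ n) ∣ ℤ.∣ t ∣)
            (≡.trans (neg-sub (+ b) (+ a)) (≡.trans (ℤ.m-n≡m⊖n a b) (ℤ.⊖-≥ b≤a)))
            (∣⇒∣ᵤ (∣m⇒∣-m d))))))
    where
    open ℤSolver.+-*-Solver
    neg-sub : ∀ s t → ℤ.- (s ℤ.- t) ≡ t ℤ.- s
    neg-sub = solve 2 (λ s t → :- (s :- t) := t :- s) refl

  residue-coherent : ∀ y k → + (p ℕ.^ k) ∣ᶻ + residue y (suc k) ℤ.- + residue y k
  residue-coherent y k = subst (+ P ∣ᶻ_) eq
    (∣m∣n⇒∣m+n (∣m∣n⇒∣m-n (coherent y k) (∣ᶻ-trans P∣P′ (divides s refl))) (divides t refl))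
    where
    open ℤSolver.+-*-Solver
    P  = p ℕ.^ k
    P′ = p ℕ.^ suc k
    a  = approx y k
    a′ = approx y (suc k)
    s  = (a′ /ℕ P′) {{p^≢0 (suc k)}}
    t  = (a /ℕ P) {{p^≢0 k}}
    P∣P′ : + P ∣ᶻ + P′
    P∣P′ = ∣ᵤ⇒∣ (n∣m*n p)
    eq : ((a′ ℤ.- a) ℤ.- s ℤ.* + P′) ℤ.+ t ℤ.* + P ≡ + residue y (suc k) ℤ.- + residue y k
    eq = ≡.trans
      (cong₂ (λ u v → ((u ℤ.- v) ℤ.- s ℤ.* + P′) ℤ.+ t ℤ.* + P)
        (a≡a%ℕn+[a/ℕn]*n a′ P′ {{p^≢0 (suc k)}}) (a≡a%ℕn+[a/ℕn]*n a P {{p^≢0 k}}))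
      (solve 4 (λ r′ u r v → (((r′ :+ u) :- (r :+ v)) :- u) :+ v := r′ :- r) refl
        (+ residue y (suc k)) (s ℤ.* + P′) (+ residue y k) (t ℤ.* + P))

  -- The continuous extension of a ↦ C(a,n) from ℕ to ℤₚ: modulo pᵏ, C(a,n)
  -- depends only on a modulo p^(k+n), since the p-part of n! divides pⁿ.
  binom : ℤₚ p → ℕ → ℤₚ p
  approx   (binom y n) k = + (residue y (k ℕ.+ n) C n)
  coherent (binom y n) k = C-cong′ n _ _ k (residue-coherent y (k ℕ.+ n))

module OneUnits {c ℓ : Level} {p : ℕ} (p-prime : Prime p) (𝔽 : FiniteField c ℓ p) where

  private module 𝔽 = FiniteField 𝔽

  open Binomial p-prime public

  -- Reduction ℤₚ → 𝔽ₚ ⊆ 𝔽.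
  reduce : ℤₚ p → 𝔽.Carrier
  reduce y = residue y 1 𝔽.×ꟳ 𝔽.1#

  -- R_K = 𝔽[[π]], as coefficient sequences.
  R : Set c
  R = ℕ → 𝔽.Carrier

  shift : ℕ → R → R
  shift zero    a n       = a n
  shift (suc m) a zero    = 𝔽.0#
  shift (suc m) a (suc n) = shift m a n

  extend : R → ℤ → 𝔽.Carrier
  extend a (+ n)    = a n
  extend a -[1+ _ ] = 𝔽.0#

  const : 𝔽.Carrier → R
  const a zero    = a
  const a (suc _) = 𝔽.0#

  _⊛_ : R → R → R
  (a ⊛ b) n = 𝔽.sum {suc n} (λ i → a (toℕ i) 𝔽.* b (n ℕ.∸ toℕ i))

  -- K = 𝔽((π)); the element with the given fields is Σₙ (coeffs n) π^(n - pole).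
  -- `pole` is not assumed minimal, so elements are compared through `coeff`.
  record K : Set c where
    constructor laurent
    field
      pole   : ℕ
      coeffs : R

  open K public

  -- The coefficient of πⁱ.
  coeff : K → ℤ → 𝔽.Carrier
  coeff x i = extend (coeffs x) (i ℤ.+ + pole x)

  K-rawRing : RawRing c ℓ
  K-rawRing = record
    { Carrier = K
    ; _≈_     = λ x y → ∀ i → coeff x i 𝔽.≈ coeff y i
    ; _+_     = λ x y → laurent (pole x ℕ.+ pole y)
                  (λ n → shift (pole y) (coeffs x) n 𝔽.+ shift (pole x) (coeffs y) n)
    ; _*_     = λ x y → laurent (pole x ℕ.+ pole y) (coeffs x ⊛ coeffs y)
    ; -_      = λ x → laurent (pole x) (λ n → 𝔽.- coeffs x n)
    ; 0#      = laurent 0 (const 𝔽.0#)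
    ; 1#      = laurent 0 (const 𝔽.1#)
    }

  open RawRing K-rawRing public using (_≈_; _+_; _*_; -_; 0#; 1#)
  open RawSemiringDefinitions (RawRing.rawSemiring K-rawRing) public using (sum; _^_)

  infixl 6 _-_
  _-_ : K → K → K
  x - y = x + (- y)

  fromR : R → K
  fromR = laurent 0

  from𝔽 : 𝔽.Carrier → K
  from𝔽 a = fromR (const a)

  -- v(x) ≥ k, i.e. |x| ≤ q^(-k); v itself is not computable, as x = 0 is undecidable.
  infix 4 v[_]≥_ ∣_∣≤∣_∣
  v[_]≥_ : K → ℤ → Set ℓ
  v[ x ]≥ k = ∀ i → i ℤ.< k → coeff x i 𝔽.≈ 𝔽.0#

  ∣_∣≤∣_∣ : K → K → Set ℓ
  ∣ x ∣≤∣ y ∣ = ∀ k → v[ y ]≥ k → v[ x ]≥ k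

  _⟶_ : (ℕ → K) → K → Set ℓ
  a ⟶ x = ∀ (k : ℕ) → ∃[ N ] ∀ n → N ℕ.≤ n → v[ a n - x ]≥ + k

  HasSum : (ℕ → K) → K → Set ℓ
  HasSum a s = (λ m → sum {m} (λ i → a (toℕ i))) ⟶ s

  -- U = 1 + π𝔽[[π]].
  record U : Set (c ⊔ ℓ) where
    constructor oneUnit
    field
      series   : R
      constant : series 0 𝔽.≈ 𝔽.1#

  open U public

  fromU : U → K
  fromU u = fromR (series u)

  U-setoid : Setoid (c ⊔ ℓ) ℓ
  U-setoid = record
    { Carrier       = U
    ; _≈_           = λ u v → fromU u ≈ fromU v
    ; isEquivalence = record
      { refl  = λ _ → 𝔽.refl
      ; sym   = λ e i → 𝔽.sym (e i)
      ; trans = λ e f i → 𝔽.trans (e i) (f i)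
      }
    }

  infix 4 _≈ᵁ_
  _≈ᵁ_ : U → U → Set ℓ
  _≈ᵁ_ = Setoid._≈_ U-setoid

  infixl 7 _·_
  _·_ : U → U → U
  series   (u · v) = series u ⊛ series v
  constant (u · v) = 𝔽.trans (𝔽.+-identityʳ _)
    (𝔽.trans (𝔽.*-cong (constant u) (constant v)) (𝔽.*-identityˡ 𝔽.1#))

  -- w = uʸ.
  IsPower : U → ℤₚ p → U → Set ℓ
  IsPower u y w = HasSum (λ n → from𝔽 (reduce (binom y n)) * (fromU u - 1#) ^ n) (fromU w)

  Continuous : (U → K) → Set (c ⊔ ℓ)
  Continuous f = ∀ u (k : ℕ) → ∃[ m ] ∀ v →
    v[ fromU v - fromU u ]≥ + m → v[ f v - f u ]≥ + k

  -- u ∈ B_{α,t}, t = |ρ|.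
  infix 4 _∈B[_,_]
  _∈B[_,_] : R → R → R → Set ℓ
  u ∈B[ α , ρ ] = ∣ fromR u - fromR α ∣≤∣ fromR ρ ∣

  -- Analyticity on a ball contained in U about α with radius t = |ρ| > 0.
  record AnalyticNear (f : U → K) (α : U) : Set (c ⊔ ℓ) where
    field
      ρ         : R
      ρ⁻¹       : K
      ρ-inverse : fromR ρ * ρ⁻¹ ≈ 1#
      B⊆U       : ∀ u → u ∈B[ series α , ρ ] → u 0 𝔽.≈ 𝔽.1#
      coef      : ℕ → K
      coef⟶0    : coef ⟶ 0#
      expansion : ∀ u → series u ∈B[ series α , ρ ] →
                  HasSum (λ n → coef n * ((fromU u - fromU α) * ρ⁻¹) ^ n) (f u)

  LocallyAnalytic : (U → K) → Set (c ⊔ ℓ)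
  LocallyAnalytic f = Continuous f × (∀ α → AnalyticNear f α)

  record Λ : Set (c ⊔ ℓ) where
    field
      map             : Func U-setoid U-setoid
    open Func map public
    field
      locallyAnalytic : LocallyAnalytic (λ u → fromU (to u))
      multiplicative  : ∀ u v → to (u · v) ≈ᵁ to u · to v

  infix 4 _≈ᴸ_
  _≈ᴸ_ : Λ → Λ → Set (c ⊔ ℓ)
  f ≈ᴸ g = ∀ u → Λ.to f u ≈ᵁ Λ.to g u

  -- Λ is a group under pointwise multiplication.
  record PointwiseGroup : Set (c ⊔ ℓ) where
    field
      _∙_       : Op₂ Λ
      ε         : Λ
      _⁻¹       : Op₁ Λ
      isGroup   : IsGroup _≈ᴸ_ _∙_ ε _⁻¹
      pointwise : ∀ f g u → Λ.to (f ∙ g) u ≈ᵁ Λ.to f u · Λ.to g u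

    rawGroup : RawGroup _ _
    rawGroup = record { Carrier = Λ ; _≈_ = _≈ᴸ_ ; _∙_ = _∙_ ; ε = ε ; _⁻¹ = _⁻¹ }

{-# OPTIONS --safe #-}
-- Write 𝔽[[π]] for the ring of integers. If f is locally analytic and
-- multiplicative, comparing the expansions at 1 of f(u)ᵖ = f(uᵖ) shows that
-- f(1 + x) = Σ aₙ xⁿ near 0 with aₙ ∈ 𝔽 and aₙᵖ = aₙ; since u^(p^k) → 1 and
-- Frobenius is injective, this holds for every x ∈ π𝔽[[π]]. Let F = Σ aₙ πⁿ.
-- Multiplicativity at 1 + π and 1 + πᴹ, modulo π²ᴹ, gives (1 + π) F′ = a₁ F,
-- which forces a₁ ∈ 𝔽ₚ. For e ∈ ℕ with e ≡ -a₁ modulo p the derivative of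
-- F (1 + π)ᵉ vanishes, so this series is H(π)ᵖ for some H with the same
-- properties as F. Iterating, F (1 + π)^(e₀ + e₁p + … + eₖ₋₁p^(k-1)) is a
-- p^k-th power of a 1-unit, which tends to 1; hence F = (1 + π)ʸ and f(u) = uʸ
-- for y = -Σ eₖ pᵏ.
module Submission where

open import Defs
open import Algebra.Bundles using (CommutativeRing)
open import Algebra.Morphism.Structures using (module GroupMorphisms)
import Algebra.Properties.CommutativeSemiring.Binomial as BinomialTheorem
import Algebra.Properties.CommutativeSemiring.Exp as CommutativeExp
import Algebra.Properties.Ring as RingProperties
import Algebra.Properties.Semiring.Exp as Exp
import Algebra.Properties.Semiring.Mult as Mult
import Algebra.Properties.Semiring.Sum as Sum
import Algebra.Solver.Ring.NaturalCoefficients.Default as SemiringSolver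
open import Algebra.Structures using (IsCommutativeRing)
open import Data.Fin.Base as Fin using (toℕ; fromℕ; inject₁)
import Data.Fin.Properties as Fin
open import Data.Integer.Base as ℤ using (+_; -[1+_])
open import Data.Integer.Divisibility.Signed using (divides; ∣⇒∣ᵤ; ∣m∣n⇒∣m+n; ∣m⇒∣-m; ∣ᵤ⇒∣) renaming (_∣_ to _∣ᶻ_; ∣-trans to ∣ᶻ-trans)
open import Data.Integer.DivMod using (_/ℕ_; a≡a%ℕn+[a/ℕn]*n; n%ℕd<d)
import Data.Integer.Properties as ℤ
import Data.Integer.Solver as ℤSolver
open import Data.Nat.Base as ℕ using (ℕ; zero; suc; NonZero; z≤n; s≤s)
open import Data.Nat.Combinatorics using (_C_; nCn≡1; nCk+nC[k+1]≡[n+1]C[k+1]; k>n⇒nCk≡0)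
open import Data.Nat.Coprimality as Coprime using (coprime-Bézout; prime⇒coprime)
open import Data.Nat.Divisibility using (_∣_; divides; >⇒∤; m∣m*n)
open import Data.Nat.DivMod using (m≡m%n+[m/n]*n; m%n<n)
open import Data.Nat.GCD using (module Bézout)
open import Data.Nat.Induction using (<-rec)
open import Data.Nat.Primality using (Prime; euclidsLemma; prime⇒nonZero; prime⇒nonTrivial)
import Data.Nat.Properties as ℕ
import Data.Nat.Solver as ℕSolver
open import Data.Product.Base using (∃-syntax; Σ-syntax; _×_; _,_; proj₁; proj₂)
open import Data.Sum.Base using (_⊎_; inj₁; inj₂)
open import Function.Base using (_∘_)
open import Function.Bundles using (Inverse)
open import Level using (Level; _⊔_)
open import Relation.Binary.Bundles using (Setoid)
open import Relation.Binary.PropositionalEquality as ≡ using (_≡_; cong; subst)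
import Relation.Binary.Reasoning.Setoid as SetoidReasoning
open import Relation.Nullary using (¬_; Dec; yes; no; contradiction)

-- Why the coefficients at 1 are constants: an expansion on a ball has coefficients in K and an
-- arbitrary radius. Exponents m and P that clear the denominators and fit the ball give π^m f(1 +
-- π^P x) = Σ bₙ xⁿ with bₙ in 𝔽[[π]], and f(u)ᵖ = f(uᵖ) turns into bₙᵖ = π^((p-1)(m+Pn)) bₙ. So bₙ
-- / π^(m+Pn) is fixed by Frobenius, and a comparison of coefficients leaves only a constant aₙ. The
-- series Σ aₙ xⁿ then converges on the whole maximal ideal, whatever the original ball was. The
-- descent replaces F by twists and p-th roots, which no longer come from the given map f. It
-- therefore runs on formal series with the property `IsCharacter`, and the fixed-point property of
-- the coefficients is derived anew from that property alone. A product of two members of Λ would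
-- have to be expanded on a common ball. Once every member is known to be a power map, the group law
-- is instead defined on exponents and shown to be pointwise.

-- Additivity of Frobenius in characteristic p.

p∣pC : ∀ {p} → Prime p → ∀ k → suc k ℕ.< p → p ∣ (p C suc k)
p∣pC {suc p} p-prime k k<p
  with euclidsLemma (suc k) (suc p C suc k) p-prime
         (subst (suc p ∣_) (≡.sym (absorption p k)) (m∣m*n (p C k)))
... | inj₁ p∣k = contradiction p∣k (>⇒∤ k<p)
... | inj₂ p∣C = p∣C

module Characteristic {a ℓ} (A : CommutativeRing a ℓ) where

  open CommutativeRing A hiding (zero)
  open Mult semiring renaming (_×_ to _⋆_)
  open Exp semiring
  open Sum semiring using (sum; sum-cong-≋; sum-init-last; sum-replicate-zero)
  open SetoidReasoning setoid

  module _ {p : ℕ} (char : p ⋆ 1# ≈ 0#) where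

    p∣n⇒n⋆≈0 : ∀ {n} → p ∣ n → ∀ x → n ⋆ x ≈ 0#
    p∣n⇒n⋆≈0 (divides q ≡.refl) x = begin
      (q ℕ.* p) ⋆ x         ≈⟨ ×-congʳ (q ℕ.* p) (*-identityˡ x) ⟨
      (q ℕ.* p) ⋆ (1# * x)  ≈⟨ ×-assoc-* (q ℕ.* p) 1# x ⟨
      (q ℕ.* p) ⋆ 1# * x    ≈⟨ *-congʳ (×1-homo-* q p) ⟩
      q ⋆ 1# * p ⋆ 1# * x   ≈⟨ *-congʳ (trans (*-congˡ char) (zeroʳ _)) ⟩
      0# * x                ≈⟨ zeroˡ x ⟩
      0#                    ∎

    freshman : Prime p → ∀ x y → (x + y) ^ p ≈ x ^ p + y ^ p
    freshman p-prime x y = expand p ≡.refl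
      where
      open BinomialTheorem commutativeSemiring using (theorem; binomialTerm)
      -- The binomial sum is split at both ends, for which the exponent must be a successor; hence
      -- the auxiliary n.
      expand : ∀ n → n ≡ p → (x + y) ^ n ≈ x ^ n + y ^ n
      expand zero    ≡.refl = contradiction p-prime λ ()
      expand (suc n) ≡.refl = begin
        (x + y) ^ suc n                      ≈⟨ theorem (suc n) x y ⟩
        t Fin.zero + sum (t ∘ Fin.suc)       ≈⟨ +-cong first (sum-init-last (t ∘ Fin.suc)) ⟩
        y ^ suc n + (sum (λ i → t (Fin.suc (inject₁ i))) + t (Fin.suc (fromℕ n)))
          ≈⟨ +-congˡ (+-cong (trans (sum-cong-≋ middle) (sum-replicate-zero n)) last) ⟩
        y ^ suc n + (0# + x ^ suc n)         ≈⟨ +-congˡ (+-identityˡ _) ⟩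
        y ^ suc n + x ^ suc n                ≈⟨ +-comm _ _ ⟩
        x ^ suc n + y ^ suc n                ∎
        where
        t = binomialTerm x y (suc n)
        first : t Fin.zero ≈ y ^ suc n
        first = trans (+-identityʳ _) (*-identityˡ _)
        last : t (Fin.suc (fromℕ n)) ≈ x ^ suc n
        last rewrite Fin.toℕ-fromℕ n | nCn≡1 (suc n) | ℕ.n∸n≡0 n =
          trans (+-identityʳ _) (*-identityʳ _)
        middle : ∀ i → t (Fin.suc (inject₁ i)) ≈ 0#
        middle i = p∣n⇒n⋆≈0 (p∣pC p-prime (toℕ (inject₁ i))
          (s≤s (subst (ℕ._< n) (≡.sym (Fin.toℕ-inject₁ i)) (Fin.toℕ<n i)))) _

    freshman^ : Prime p → ∀ k x y → (x + y) ^ (p ℕ.^ k) ≈ x ^ (p ℕ.^ k) + y ^ (p ℕ.^ k)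
    freshman^ p-prime zero    x y = trans (*-identityʳ _) (sym (+-cong (*-identityʳ x) (*-identityʳ y)))
    freshman^ p-prime (suc k) x y = begin
      (x + y) ^ (p ℕ.* q)             ≈⟨ ^-assocʳ (x + y) p q ⟨
      ((x + y) ^ p) ^ q               ≈⟨ ^-congˡ q (freshman p-prime x y) ⟩
      (x ^ p + y ^ p) ^ q             ≈⟨ freshman^ p-prime k (x ^ p) (y ^ p) ⟩
      (x ^ p) ^ q + (y ^ p) ^ q       ≈⟨ +-cong (^-assocʳ x p q) (^-assocʳ y p q) ⟩
      x ^ (p ℕ.* q) + y ^ (p ℕ.* q)   ∎
      where q = p ℕ.^ k

-- The ring 𝔽[[π]].

module PowerSeries {c ℓ : Level} {p : ℕ} (p-prime : Prime p) (𝔽 : FiniteField c ℓ p) where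

  module F where
    open FiniteField 𝔽 public renaming (_×ꟳ_ to _⋆_)
    open Exp semiring public
    open Mult semiring public hiding (_×_)
    open Characteristic commutativeRing public
    open SemiringSolver commutativeSemiring public using (solve; _:+_; _:*_; _:=_; con)

  open OneUnits p-prime 𝔽 using (R; const; shift; _⊛_)

  tail : R → R
  tail a n = a (suc n)

  opaque

    infix 4 _≋_
    _≋_ : R → R → Set ℓ
    a ≋ b = ∀ n → a n F.≈ b n

    _⊕_ : R → R → R
    (a ⊕ b) n = a n F.+ b n

    _⊗_ : R → R → R
    _⊗_ = _⊛_

    ⊖_ : R → R
    (⊖ a) n = F.- a n

    𝟘 : R
    𝟘 _ = F.0#

    at : ∀ {a b} → a ≋ b → ∀ n → a n F.≈ b n
    at e = e

    pointwise : ∀ {a b} → (∀ n → a n F.≈ b n) → a ≋ b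
    pointwise e = e

    ⊗-def : ∀ a b → a ⊗ b ≡ a ⊛ b
    ⊗-def a b = ≡.refl

    ⊕-at : ∀ a b n → (a ⊕ b) n ≡ a n F.+ b n
    ⊕-at a b n = ≡.refl

    ⊖-at : ∀ a n → (⊖ a) n ≡ F.- a n
    ⊖-at a n = ≡.refl

    𝟘-at : ∀ n → 𝟘 n ≡ F.0#
    𝟘-at n = ≡.refl

    ⊗-zero : ∀ a b → (a ⊗ b) 0 F.≈ a 0 F.* b 0
    ⊗-zero a b = F.+-identityʳ _

    ⊗-suc : ∀ a b n → (a ⊗ b) (suc n) F.≈ a 0 F.* b (suc n) F.+ (tail a ⊗ b) n
    ⊗-suc a b n = F.refl

    ⊗-cong : ∀ {a a′ b b′} → a ≋ a′ → b ≋ b′ → a ⊗ b ≋ a′ ⊗ b′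
    ⊗-cong d e zero    = F.+-congʳ (F.*-cong (d 0) (e 0))
    ⊗-cong d e (suc n) = F.+-cong (F.*-cong (d 0) (e (suc n))) (⊗-cong (λ m → d (suc m)) e n)

    -- The convolution recurses on its left factor; the same recursion on the right factor makes
    -- commutativity a plain induction.
    ⊗-sucʳ : ∀ a b n → (a ⊗ b) (suc n) F.≈ a (suc n) F.* b 0 F.+ (a ⊗ tail b) n
    ⊗-sucʳ a b zero    = F.trans (F.+-congˡ (F.+-identityʳ _)) (F.trans (F.+-comm _ _) (F.+-congˡ (F.sym (F.+-identityʳ _))))
    ⊗-sucʳ a b (suc n) = F.trans (F.+-congˡ (⊗-sucʳ (tail a) b n))
      (F.solve 3 (λ x y z → x F.:+ (y F.:+ z) F.:= y F.:+ (x F.:+ z)) F.refl _ _ _)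

    ⊗-comm : ∀ a b → a ⊗ b ≋ b ⊗ a
    ⊗-comm a b zero    = F.+-congʳ (F.*-comm _ _)
    ⊗-comm a b (suc n) = F.trans (F.+-cong (F.*-comm _ _) (⊗-comm (tail a) b n))
      (F.sym (⊗-sucʳ b a n))

    ⊗-distribʳ : ∀ a b d → (b ⊕ d) ⊗ a ≋ (b ⊗ a) ⊕ (d ⊗ a)
    ⊗-distribʳ a b d zero    = F.solve 3 (λ x y z → (y F.:+ z) F.:* x F.:+ F.con 0 F.:= (y F.:* x F.:+ F.con 0) F.:+ (z F.:* x F.:+ F.con 0)) F.refl _ _ _
    ⊗-distribʳ a b d (suc n) = F.trans (F.+-congˡ (⊗-distribʳ a (tail b) (tail d) n))
      (F.solve 5 (λ x y z v w → (y F.:+ z) F.:* x F.:+ (v F.:+ w) F.:= (y F.:* x F.:+ v) F.:+ (z F.:* x F.:+ w)) F.refl _ _ _ _ _)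

    scale-⊗ : ∀ s a b n → ((λ m → s F.* a m) ⊗ b) n F.≈ s F.* (a ⊗ b) n
    scale-⊗ s a b zero    = F.solve 3 (λ s a b → (s F.:* a) F.:* b F.:+ F.con 0 F.:= s F.:* (a F.:* b F.:+ F.con 0)) F.refl _ _ _
    scale-⊗ s a b (suc n) = F.trans (F.+-congˡ (scale-⊗ s (tail a) b n))
      (F.solve 4 (λ s a b c → (s F.:* a) F.:* b F.:+ s F.:* c F.:= s F.:* (a F.:* b F.:+ c)) F.refl _ _ _ _)

    ⊗-assoc : ∀ a b d → (a ⊗ b) ⊗ d ≋ a ⊗ (b ⊗ d)
    ⊗-assoc a b d zero    = F.solve 3 (λ a b c → (a F.:* b F.:+ F.con 0) F.:* c F.:+ F.con 0 F.:= a F.:* (b F.:* c F.:+ F.con 0) F.:+ F.con 0) F.refl _ _ _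
    ⊗-assoc a b d (suc n) = begin
      (a ⊗ b) 0 F.* d (suc n) F.+ (tail (a ⊗ b) ⊗ d) n
        ≈⟨ F.+-congˡ (⊗-distribʳ d (λ m → a 0 F.* b (suc m)) (tail a ⊗ b) n) ⟩
      (a ⊗ b) 0 F.* d (suc n) F.+ (((λ m → a 0 F.* b (suc m)) ⊗ d) n F.+ ((tail a ⊗ b) ⊗ d) n)
        ≈⟨ F.+-congˡ (F.+-cong (scale-⊗ (a 0) (tail b) d n) (⊗-assoc (tail a) b d n)) ⟩
      (a ⊗ b) 0 F.* d (suc n) F.+ (a 0 F.* (tail b ⊗ d) n F.+ (tail a ⊗ (b ⊗ d)) n)
        ≈⟨ F.solve 5 (λ a b c v w → (a F.:* b F.:+ F.con 0) F.:* c F.:+ (a F.:* v F.:+ w) F.:= a F.:* (b F.:* c F.:+ v) F.:+ w) F.refl _ _ _ _ _ ⟩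
      a 0 F.* (b ⊗ d) (suc n) F.+ (tail a ⊗ (b ⊗ d)) n ∎
      where open SetoidReasoning F.setoid

    const𝟘-⊗ : ∀ a n → ((λ _ → F.0#) ⊗ a) n F.≈ F.0#
    const𝟘-⊗ a zero    = F.trans (F.+-identityʳ _) (F.zeroˡ _)
    const𝟘-⊗ a (suc n) = F.trans (F.+-cong (F.zeroˡ _) (const𝟘-⊗ a n)) (F.+-identityʳ _)

    const-⊗ : ∀ s a n → (const s ⊗ a) n F.≈ s F.* a n
    const-⊗ s a zero    = F.+-identityʳ _
    const-⊗ s a (suc n) = F.trans (F.+-congˡ (const𝟘-⊗ a n)) (F.+-identityʳ _)

    ⊗-identityˡ : ∀ a → const F.1# ⊗ a ≋ a
    ⊗-identityˡ a n = F.trans (const-⊗ F.1# a n) (F.*-identityˡ _)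

    ⊗-⊕-isCommutativeRing : IsCommutativeRing _≋_ _⊕_ _⊗_ ⊖_ 𝟘 (const F.1#)
    ⊗-⊕-isCommutativeRing = record
      { isRing = record
        { +-isAbelianGroup = record
          { isGroup = record
            { isMonoid = record
              { isSemigroup = record
                { isMagma = record
                  { isEquivalence = record
                    { refl = λ _ → F.refl ; sym = λ e n → F.sym (e n) ; trans = λ d e n → F.trans (d n) (e n) }
                  ; ∙-cong = λ d e n → F.+-cong (d n) (e n)
                  }
                ; assoc = λ _ _ _ _ → F.+-assoc _ _ _
                }
              ; identity = (λ _ _ → F.+-identityˡ _) , (λ _ _ → F.+-identityʳ _)
              }
            ; inverse = (λ _ _ → F.-‿inverseˡ _) , (λ _ _ → F.-‿inverseʳ _)
            ; ⁻¹-cong = λ e n → F.-‿cong (e n)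
            }
          ; comm = λ _ _ _ → F.+-comm _ _
          }
        ; *-cong = ⊗-cong
        ; *-assoc = ⊗-assoc
        ; *-identity = ⊗-identityˡ , (λ a n → F.trans (⊗-comm a (const F.1#) n) (⊗-identityˡ a n))
        ; distrib = (λ a b d n → F.trans (⊗-comm a (b ⊕ d) n) (F.trans (⊗-distribʳ a b d n) (F.+-cong (⊗-comm b a n) (⊗-comm d a n)))) , ⊗-distribʳ
        }
      ; *-comm = ⊗-comm
      }

  ℛ : CommutativeRing c ℓ
  ℛ = record { isCommutativeRing = ⊗-⊕-isCommutativeRing }

-- The finite field: decidable equality, Frobenius, the prime field.

module Field {c ℓ : Level} {p : ℕ} (p-prime : Prime p) (𝔽 : FiniteField c ℓ p) where

  open FiniteField 𝔽 hiding (zero) renaming (_×ꟳ_ to _⋆_)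
  open Exp semiring
  open Mult semiring hiding (_×_)
  open Characteristic commutativeRing
  open SetoidReasoning setoid

  infix 4 _≟_
  _≟_ : ∀ x y → Dec (x ≈ y)
  x ≟ y with Inverse.to enumeration x Fin.≟ Inverse.to enumeration y
  ... | yes e = yes (trans (sym (Inverse.inverseʳ enumeration ≡.refl))
                     (trans (Inverse.from-cong enumeration e) (Inverse.inverseʳ enumeration ≡.refl)))
  ... | no ne = no λ e → ne (Inverse.to-cong enumeration e)

  xy≈0⇒y≈0 : ∀ {x y} → ¬ (x ≈ 0#) → x * y ≈ 0# → y ≈ 0#
  xy≈0⇒y≈0 {x} {y} x≉0 xy≈0 with inverse x x≉0
  ... | x⁻¹ , xx⁻¹≈1 = begin
    y              ≈⟨ *-identityˡ y ⟨
    1# * y         ≈⟨ *-congʳ (trans (sym xx⁻¹≈1) (*-comm x x⁻¹)) ⟩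
    x⁻¹ * x * y    ≈⟨ *-assoc x⁻¹ x y ⟩
    x⁻¹ * (x * y)  ≈⟨ *-congˡ xy≈0 ⟩
    x⁻¹ * 0#       ≈⟨ zeroʳ x⁻¹ ⟩
    0#             ∎

  x^n≈0⇒x≈0 : ∀ n {x} → x ^ n ≈ 0# → x ≈ 0#
  x^n≈0⇒x≈0 zero    1≈0 = contradiction (sym 1≈0) 0≉1
  x^n≈0⇒x≈0 (suc n) {x} e with x ≟ 0#
  ... | yes x≈0 = x≈0
  ... | no x≉0  = x^n≈0⇒x≈0 n (xy≈0⇒y≈0 x≉0 e)

  x-y≈0⇒x≈y : ∀ {x y} → x - y ≈ 0# → x ≈ y
  x-y≈0⇒x≈y {x} {y} = RingProperties.x∙y⁻¹≈ε⇒x≈y ring x y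

  -- Additivity is applied to (x - y) + y, which gives (x - y)ᵖ + yᵖ = xᵖ without having to
  -- determine the sign (-1)ᵖ.
  frobenius-injective : ∀ {x y} → x ^ p ≈ y ^ p → x ≈ y
  frobenius-injective {x} {y} e = x-y≈0⇒x≈y (x^n≈0⇒x≈0 p
    (RingProperties.+-cancelʳ ring (y ^ p) _ _ (begin
      (x - y) ^ p + y ^ p  ≈⟨ freshman characteristic p-prime (x - y) y ⟨
      (x - y + y) ^ p      ≈⟨ ^-congˡ p (trans (+-assoc x (- y) y) (trans (+-congˡ (-‿inverseˡ y)) (+-identityʳ x))) ⟩
      x ^ p                ≈⟨ e ⟩
      y ^ p                ≈⟨ +-identityˡ _ ⟨
      0# + y ^ p           ∎)))

  -- A Bézout relation between n and p would turn n · 1 = 0 into 1 = 0.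
  0<n<p⇒n⋆1≉0 : ∀ {n} → .{{NonZero n}} → n ℕ.< p → ¬ (n ⋆ 1# ≈ 0#)
  0<n<p⇒n⋆1≉0 {n} n<p n≈0 with coprime-Bézout (Coprime.sym (prime⇒coprime p-prime n<p))
  ... | Bézout.Identity.+- a b 1+bp≡an = 0≉1 (begin
    0#                        ≈⟨ p∣n⇒n⋆≈0 n≈0 (divides a ≡.refl) 1# ⟨
    (a ℕ.* n) ⋆ 1#            ≈⟨ ×-congˡ 1+bp≡an ⟨
    1# + (b ℕ.* p) ⋆ 1#       ≈⟨ +-congˡ (p∣n⇒n⋆≈0 characteristic (divides b ≡.refl) 1#) ⟩
    1# + 0#                   ≈⟨ +-identityʳ 1# ⟩
    1#                        ∎)
  ... | Bézout.Identity.-+ a b 1+an≡bp = 0≉1 (begin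
    0#                        ≈⟨ p∣n⇒n⋆≈0 characteristic (divides b ≡.refl) 1# ⟨
    (b ℕ.* p) ⋆ 1#            ≈⟨ ×-congˡ 1+an≡bp ⟨
    1# + (a ℕ.* n) ⋆ 1#       ≈⟨ +-congˡ (p∣n⇒n⋆≈0 n≈0 (divides a ≡.refl) 1#) ⟩
    1# + 0#                   ≈⟨ +-identityʳ 1# ⟩
    1#                        ∎)

  n⋆x≈[n⋆1]x : ∀ n x → n ⋆ x ≈ n ⋆ 1# * x
  n⋆x≈[n⋆1]x n x = trans (×-congʳ n (sym (*-identityˡ x))) (sym (×-assoc-* n 1# x))

  [np+j]⋆1≈j⋆1 : ∀ n j → (n ℕ.* p ℕ.+ j) ⋆ 1# ≈ j ⋆ 1#
  [np+j]⋆1≈j⋆1 n j = begin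
    (n ℕ.* p ℕ.+ j) ⋆ 1#          ≈⟨ ×-homo-+ 1# (n ℕ.* p) j ⟩
    (n ℕ.* p) ⋆ 1# + j ⋆ 1#       ≈⟨ +-congʳ (p∣n⇒n⋆≈0 characteristic (divides n ≡.refl) 1#) ⟩
    0# + j ⋆ 1#                   ≈⟨ +-identityˡ _ ⟩
    j ⋆ 1#                        ∎

-- Congruences modulo powers of π.

module Truncation {c ℓ : Level} {p : ℕ} (p-prime : Prime p) (𝔽 : FiniteField c ℓ p) where

  open PowerSeries p-prime 𝔽 public
  open OneUnits p-prime 𝔽 public using (R; const; shift)
  open CommutativeRing ℛ public hiding (zero)
  open Exp semiring public
  open CommutativeExp commutativeSemiring public using (^-distrib-*)
  open Mult semiring public hiding (_×_)
  open Mult semiring public using () renaming (_×_ to _⋆_)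
  open Characteristic ℛ public
  open Field p-prime 𝔽 public
  open SemiringSolver commutativeSemiring public using (solve; _:+_; _:*_; _:=_; con)
  open SetoidReasoning setoid

  instance
    p≢0 : NonZero p
    p≢0 = prime⇒nonZero p-prime

  infix 4 _≈[_]_
  -- Congruence modulo π^N. Equalities between limits are reduced to it through `limit`.
  record _≈[_]_ (a : R) (N : ℕ) (b : R) : Set ℓ where
    constructor trunc
    field below : ∀ n → n ℕ.< N → a n F.≈ b n

  open _≈[_]_ public

  trunc-≈ : ∀ {N a b} → a ≈ b → a ≈[ N ] b
  trunc-≈ e = trunc λ n _ → at e n

  limit : ∀ {a b} → (∀ N → a ≈[ N ] b) → a ≈ b
  limit e = pointwise λ n → below (e (suc n)) n (ℕ.n<1+n n)

  trunc-refl : ∀ {N a} → a ≈[ N ] a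
  trunc-refl = trunc λ _ _ → F.refl

  trunc-sym : ∀ {N a b} → a ≈[ N ] b → b ≈[ N ] a
  trunc-sym e = trunc λ n n<N → F.sym (below e n n<N)

  trunc-trans : ∀ {N a b d} → a ≈[ N ] b → b ≈[ N ] d → a ≈[ N ] d
  trunc-trans e f = trunc λ n n<N → F.trans (below e n n<N) (below f n n<N)

  truncSetoid : ℕ → Setoid c ℓ
  truncSetoid N = record
    { Carrier = R ; _≈_ = _≈[ N ]_
    ; isEquivalence = record { refl = trunc-refl ; sym = trunc-sym ; trans = trunc-trans } }

  coarsen : ∀ {M N a b} → M ℕ.≤ N → a ≈[ N ] b → a ≈[ M ] b
  coarsen M≤N e = trunc λ n n<M → below e n (ℕ.<-≤-trans n<M M≤N)

  trunc-0 : ∀ {a b} → a ≈[ 0 ] b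
  trunc-0 = trunc λ _ ()

  trunc-1 : ∀ {a b} → a 0 F.≈ b 0 → a ≈[ 1 ] b
  trunc-1 e = trunc λ { zero _ → e ; (suc _) (s≤s ()) }

  trunc-+ : ∀ {N a a′ b b′} → a ≈[ N ] a′ → b ≈[ N ] b′ → a + b ≈[ N ] a′ + b′
  trunc-+ {_} {a} {a′} {b} {b′} e f = trunc λ n n<N →
    ≡.subst₂ F._≈_ (≡.sym (⊕-at a b n)) (≡.sym (⊕-at a′ b′ n)) (F.+-cong (below e n n<N) (below f n n<N))

  trunc-* : ∀ {N a a′ b b′} → a ≈[ N ] a′ → b ≈[ N ] b′ → a * b ≈[ N ] a′ * b′
  trunc-* {N} e f = trunc λ n n<N → go n (λ m m≤n → below e m (ℕ.≤-<-trans m≤n n<N)) (λ m m≤n → below f m (ℕ.≤-<-trans m≤n n<N))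
    where
    go : ∀ n {a a′ b b′} → (∀ m → m ℕ.≤ n → a m F.≈ a′ m) → (∀ m → m ℕ.≤ n → b m F.≈ b′ m) → (a * b) n F.≈ (a′ * b′) n
    go zero    {a} {a′} {b} {b′} e f = F.trans (⊗-zero a b) (F.trans (F.*-cong (e 0 z≤n) (f 0 z≤n)) (F.sym (⊗-zero a′ b′)))
    go (suc n) {a} {a′} {b} {b′} e f = F.trans (⊗-suc a b n)
      (F.trans (F.+-cong (F.*-cong (e 0 z≤n) (f (suc n) ℕ.≤-refl))
                         (go n (λ m m≤n → e (suc m) (s≤s m≤n)) (λ m m≤n → f m (ℕ.m≤n⇒m≤1+n m≤n))))
      (F.sym (⊗-suc a′ b′ n)))

  trunc-^ : ∀ {N a b} k → a ≈[ N ] b → a ^ k ≈[ N ] b ^ k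
  trunc-^ zero    e = trunc-refl
  trunc-^ (suc k) e = trunc-* e (trunc-^ k e)

  π : R
  π = shift 1 (const F.1#)

  π*-zero : ∀ a → (π * a) 0 F.≈ F.0#
  π*-zero a = F.trans (⊗-zero π a) (F.zeroˡ _)

  π*-suc : ∀ a n → (π * a) (suc n) F.≈ a n
  π*-suc a n = F.trans (⊗-suc π a n) (F.trans (F.+-cong (F.zeroˡ _) (at (*-identityˡ a) n)) (F.+-identityˡ _))

  π^*-below : ∀ k a n → n ℕ.< k → (π ^ k * a) n F.≈ F.0#
  π^*-below (suc k) a zero    _         = F.trans (at (*-assoc π (π ^ k) a) 0) (π*-zero (π ^ k * a))
  π^*-below (suc k) a (suc n) (s≤s n<k) = F.trans (at (*-assoc π (π ^ k) a) (suc n))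
    (F.trans (π*-suc (π ^ k * a) n) (π^*-below k a n n<k))

  π^*-at : ∀ k a n → (π ^ k * a) (k ℕ.+ n) F.≈ a n
  π^*-at zero    a n = at (*-identityˡ a) n
  π^*-at (suc k) a n = F.trans (at (*-assoc π (π ^ k) a) (suc (k ℕ.+ n)))
    (F.trans (π*-suc (π ^ k * a) (k ℕ.+ n)) (π^*-at k a n))

  shift-π : ∀ k a → shift k a ≈ π ^ k * a
  shift-π zero    a = sym (*-identityˡ a)
  shift-π (suc k) a = pointwise λ where
    zero    → F.sym (π^*-below (suc k) a 0 (s≤s z≤n))
    (suc n) → F.trans (at (shift-π k a) n) (F.sym (F.trans (at (*-assoc π (π ^ k) a) (suc n)) (π*-suc (π ^ k * a) n)))

  split : ∀ k n → n ℕ.< k ⊎ ∃[ m ] n ≡ k ℕ.+ m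
  split k n with ℕ.<-≤-connex n k
  ... | inj₁ n<k = inj₁ n<k
  ... | inj₂ k≤n = inj₂ (n ℕ.∸ k , ≡.sym (ℕ.m+[n∸m]≡n k≤n))

  π^*-unique : ∀ k {a b} → (∀ n → n ℕ.< k → b n F.≈ F.0#) → (∀ n → b (k ℕ.+ n) F.≈ a n) → b ≈ π ^ k * a
  π^*-unique k {a} {b} lo hi = pointwise go
    where
    go : ∀ n → b n F.≈ (π ^ k * a) n
    go n with split k n
    ... | inj₁ n<k          = F.trans (lo n n<k) (F.sym (π^*-below k a n n<k))
    ... | inj₂ (m , ≡.refl) = F.trans (hi m) (F.sym (π^*-at k a m))

  drop : ℕ → R → R
  drop k a n = a (k ℕ.+ n)

  factor : ∀ {k a} → a ≈[ k ] 0# → a ≈ π ^ k * drop k a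
  factor {k} e = π^*-unique k (λ n n<k → F.trans (below e n n<k) (F.reflexive (𝟘-at n))) (λ _ → F.refl)

  π^-cancel : ∀ k {a b} → π ^ k * a ≈ π ^ k * b → a ≈ b
  π^-cancel k {a} {b} e = pointwise λ n →
    F.trans (F.sym (π^*-at k a n)) (F.trans (at e (k ℕ.+ n)) (π^*-at k b n))

  trunc-π^* : ∀ k {N a b} → a ≈[ N ] b → π ^ k * a ≈[ k ℕ.+ N ] π ^ k * b
  trunc-π^* k {N} {a} {b} e = trunc go
    where
    go : ∀ n → n ℕ.< k ℕ.+ N → (π ^ k * a) n F.≈ (π ^ k * b) n
    go n n<k+N with split k n
    ... | inj₁ n<k          = F.trans (π^*-below k a n n<k) (F.sym (π^*-below k b n n<k))
    ... | inj₂ (m , ≡.refl) = F.trans (π^*-at k a m) (F.trans (below e m (ℕ.+-cancelˡ-< k m N n<k+N)) (F.sym (π^*-at k b m)))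

  trunc-π^-cancel : ∀ k {N a b} → π ^ k * a ≈[ k ℕ.+ N ] π ^ k * b → a ≈[ N ] b
  trunc-π^-cancel k {N} {a} {b} e = trunc λ n n<N →
    F.trans (F.sym (π^*-at k a n)) (F.trans (below e (k ℕ.+ n) (ℕ.+-monoʳ-< k n<N)) (π^*-at k b n))

  -- Since z is π^M times a series, it improves a congruence by M digits.
  trunc-*ˡ : ∀ {M N z a b} → z ≈[ M ] 0# → a ≈[ N ] b → z * a ≈[ M ℕ.+ N ] z * b
  trunc-*ˡ {M} {N} {z} {a} {b} e f =
    trunc-trans (trunc-≈ (rearrange a)) (trunc-trans (trunc-π^* M (trunc-* trunc-refl f)) (trunc-≈ (sym (rearrange b))))
    where
    rearrange : ∀ a → z * a ≈ π ^ M * (drop M z * a)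
    rearrange a = trans (*-congʳ (factor e)) (*-assoc _ _ _)

  trunc-*-0 : ∀ {M N x y} → x ≈[ M ] 0# → y ≈[ N ] 0# → x * y ≈[ M ℕ.+ N ] 0#
  trunc-*-0 {x = x} e f = trunc-trans (trunc-*ˡ e f) (trunc-≈ (zeroʳ x))

  trunc-^-0 : ∀ {x} k → x ≈[ 1 ] 0# → x ^ k ≈[ k ] 0#
  trunc-^-0 zero    e = trunc-0
  trunc-^-0 (suc k) e = trunc-*-0 e (trunc-^-0 k e)

  π^≈0 : ∀ k → π ^ k ≈[ k ] 0#
  π^≈0 k = trunc-^-0 k (trunc-1 (F.reflexive (≡.sym (𝟘-at 0))))

  const-cong : ∀ {x y} → x F.≈ y → const x ≈ const y
  const-cong e = pointwise λ { zero → e ; (suc _) → F.refl }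

  const-0 : const F.0# ≈ 0#
  const-0 = pointwise λ { zero → F.reflexive (≡.sym (𝟘-at 0)) ; (suc n) → F.reflexive (≡.sym (𝟘-at (suc n))) }

  const-+ : ∀ x y → const (x F.+ y) ≈ const x + const y
  const-+ x y = pointwise λ where
    zero    → F.reflexive (≡.sym (⊕-at (const x) (const y) 0))
    (suc n) → F.trans (F.sym (F.+-identityʳ _)) (F.reflexive (≡.sym (⊕-at (const x) (const y) (suc n))))

  const-* : ∀ x y → const (x F.* y) ≈ const x * const y
  const-* x y = pointwise λ where
    zero    → F.sym (const-⊗ x (const y) 0)
    (suc n) → F.sym (F.trans (const-⊗ x (const y) (suc n)) (F.zeroʳ x))

  const-^ : ∀ x n → const (x F.^ n) ≈ const x ^ n
  const-^ x zero    = refl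
  const-^ x (suc n) = trans (const-* x _) (*-congˡ (const-^ x n))

  horner : ∀ a → a ≈ const (a 0) + π * tail a
  horner a = pointwise λ where
    zero    → F.sym (F.trans (F.reflexive (⊕-at (const (a 0)) (π * tail a) 0)) (F.trans (F.+-congˡ (π*-zero (tail a))) (F.+-identityʳ _)))
    (suc n) → F.sym (F.trans (F.reflexive (⊕-at (const (a 0)) (π * tail a) (suc n))) (F.trans (F.+-identityˡ _) (π*-suc (tail a) n)))

  ⋆-at : ∀ k a n → (k ⋆ a) n F.≈ k F.⋆ a n
  ⋆-at zero    a n = F.reflexive (𝟘-at n)
  ⋆-at (suc k) a n = F.trans (F.reflexive (⊕-at a (k ⋆ a) n)) (F.+-congˡ (⋆-at k a n))

  charℛ : p ⋆ 1# ≈ 0#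
  charℛ = pointwise λ n → F.trans (⋆-at p 1# n) (F.trans (p∣n⋆0 n) (F.reflexive (≡.sym (𝟘-at n))))
    where
    p∣n⋆0 : ∀ n → p F.⋆ const F.1# n F.≈ F.0#
    p∣n⋆0 n = F.p∣n⇒n⋆≈0 F.characteristic {p} (divides 1 (≡.sym (ℕ.*-identityˡ p))) _

  frobenius-+ : ∀ x y → (x + y) ^ p ≈ x ^ p + y ^ p
  frobenius-+ = freshman charℛ p-prime

  -- Coefficientwise form of rᵖ = Σ rₙᵖ π^(np). Splitting off the constant term gives rᵖ = r₀ᵖ + πᵖ
  -- (`tail r`)ᵖ, which is iterated. The `const` on the right covers both j = 0 and the vanishing
  -- for 0 < j < p.
  frobenius-at : ∀ n j → j ℕ.< p → ∀ r → (r ^ p) (n ℕ.* p ℕ.+ j) F.≈ const (r n F.^ p) j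
  frobenius-at n j j<p r = F.trans (at expand (n ℕ.* p ℕ.+ j)) (go n)
    where
    s = (tail r) ^ p
    expand : r ^ p ≈ const (r 0 F.^ p) + π ^ p * s
    expand = begin
      r ^ p                                ≈⟨ ^-congˡ p (horner r) ⟩
      (const (r 0) + π * tail r) ^ p       ≈⟨ frobenius-+ _ _ ⟩
      const (r 0) ^ p + (π * tail r) ^ p   ≈⟨ +-cong (sym (const-^ (r 0) p)) (^-distrib-* π (tail r) p) ⟩
      const (r 0 F.^ p) + π ^ p * s        ∎
    const-suc : ∀ x {k} → 0 ℕ.< k → const x k F.≈ F.0#
    const-suc x (s≤s _) = F.refl
    go : ∀ n → (const (r 0 F.^ p) + π ^ p * s) (n ℕ.* p ℕ.+ j) F.≈ const (r n F.^ p) j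
    go zero    = F.trans (F.reflexive (⊕-at _ _ j)) (F.trans (F.+-congˡ (π^*-below p s j j<p)) (F.+-identityʳ _))
    go (suc n) = F.trans (F.reflexive (⊕-at (const (r 0 F.^ p)) _ (p ℕ.+ n ℕ.* p ℕ.+ j)))
      (F.trans (F.+-cong (const-suc _ (ℕ.<-≤-trans (ℕ.>-nonZero⁻¹ p) (ℕ.≤-trans (ℕ.m≤m+n p _) (ℕ.m≤m+n _ j))))
         (F.trans (F.reflexive (cong (π ^ p * s) (ℕ.+-assoc p (n ℕ.* p) j))) (F.trans (π^*-at p s (n ℕ.* p ℕ.+ j)) (frobenius-at n j j<p (tail r)))))
       (F.+-identityˡ _))

  frobeniusR-injective : ∀ {r s} → r ^ p ≈ s ^ p → r ≈ s
  frobeniusR-injective {r} {s} e = pointwise λ n → frobenius-injective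
    (F.trans (F.sym (frobenius-at n 0 (ℕ.>-nonZero⁻¹ p) r)) (F.trans (at e (n ℕ.* p ℕ.+ 0)) (frobenius-at n 0 (ℕ.>-nonZero⁻¹ p) s)))

  frobenius^-injective : ∀ k {r s} → r ^ (p ℕ.^ k) ≈ s ^ (p ℕ.^ k) → r ≈ s
  frobenius^-injective zero    e = trans (sym (*-identityʳ _)) (trans e (*-identityʳ _))
  frobenius^-injective (suc k) {r} {s} e = frobeniusR-injective (frobenius^-injective k
    (trans (^-assocʳ r p (p ℕ.^ k)) (trans e (sym (^-assocʳ s p (p ℕ.^ k))))))

  1^ : ∀ n → 1# ^ n ≈ 1#
  1^ zero    = refl
  1^ (suc n) = trans (*-identityˡ _) (1^ n)

-- Evaluation of power series on the maximal ideal.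

module Evaluation {c ℓ : Level} {p : ℕ} (p-prime : Prime p) (𝔽 : FiniteField c ℓ p) where

  open Truncation p-prime 𝔽
  open SetoidReasoning setoid

  -- The partial sum Σ bₙ xⁿ over n < k in Horner form, so that identities between sums become
  -- inductions on one Horner step.
  S : ℕ → (ℕ → R) → R → R
  S zero    b x = 0#
  S (suc k) b x = b 0 + x * S k (b ∘ suc) x

  S-trunc : ∀ {N} k {b b′ x x′} → (∀ n → b n ≈[ N ] b′ n) → x ≈[ N ] x′ → S k b x ≈[ N ] S k b′ x′
  S-trunc zero    d e = trunc-refl
  S-trunc (suc k) d e = trunc-+ (d 0) (trunc-* e (S-trunc k (d ∘ suc) e))

  S-cong : ∀ k {b b′ x x′} → (∀ n → b n ≈ b′ n) → x ≈ x′ → S k b x ≈ S k b′ x′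
  S-cong k d e = limit λ N → S-trunc k (trunc-≈ ∘ d) (trunc-≈ e)

  -- Each Horner step carries a factor x, hence one more power of π, so the terms from index k on
  -- vanish modulo π^k.
  S-stable : ∀ {k l} b {x} → x ≈[ 1 ] 0# → k ℕ.≤ l → S k b x ≈[ k ] S l b x
  S-stable b x≈0 z≤n       = trunc-0
  S-stable b x≈0 (s≤s k≤l) = trunc-+ trunc-refl (trunc-*ˡ x≈0 (S-stable (b ∘ suc) x≈0 k≤l))

  opaque

    -- The sum Σ bₙ xⁿ, meaningful only if x ≈[ 1 ] 0#.
    ev : (ℕ → R) → R → R
    ev b x n = S (suc n) b x n

    ev≈S : ∀ {k l} b {x} → x ≈[ 1 ] 0# → k ℕ.≤ l → ev b x ≈[ k ] S l b x
    ev≈S b x≈0 k≤l = trunc λ n n<k → below (S-stable b x≈0 (ℕ.≤-trans n<k k≤l)) n (ℕ.n<1+n n)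

    ev-trunc : ∀ {N b b′ x x′} → (∀ n → b n ≈[ N ] b′ n) → x ≈[ N ] x′ → ev b x ≈[ N ] ev b′ x′
    ev-trunc d e = trunc λ n n<N → below (S-trunc (suc n) d e) n n<N

  ev-unique : ∀ b {x r} → x ≈[ 1 ] 0# → (∀ k → S k b x ≈[ k ] r) → ev b x ≈ r
  ev-unique b x≈0 e = limit λ k → trunc-trans (ev≈S b x≈0 ℕ.≤-refl) (e k)

  ev-cong : ∀ {b b′ x x′} → (∀ n → b n ≈ b′ n) → x ≈ x′ → ev b x ≈ ev b′ x′
  ev-cong d e = limit λ N → ev-trunc (trunc-≈ ∘ d) (trunc-≈ e)

  ev-horner : ∀ b {x} → x ≈[ 1 ] 0# → ev b x ≈ b 0 + x * ev (b ∘ suc) x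
  ev-horner b {x} x≈0 = limit λ k → trunc-trans (ev≈S b x≈0 (ℕ.n≤1+n k))
    (trunc-+ trunc-refl (trunc-* trunc-refl (trunc-sym (ev≈S (b ∘ suc) x≈0 ℕ.≤-refl))))

  S-+ : ∀ k b b′ x → S k (λ n → b n + b′ n) x ≈ S k b x + S k b′ x
  S-+ zero    b b′ x = sym (+-identityˡ 0#)
  S-+ (suc k) b b′ x = trans (+-congˡ (*-congˡ (S-+ k (b ∘ suc) (b′ ∘ suc) x)))
    (solve 5 (λ b b′ x s s′ → (b :+ b′) :+ x :* (s :+ s′) := (b :+ x :* s) :+ (b′ :+ x :* s′)) refl _ _ _ _ _)

  ev-+ : ∀ b b′ {x} → x ≈[ 1 ] 0# → ev (λ n → b n + b′ n) x ≈ ev b x + ev b′ x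
  ev-+ b b′ {x} x≈0 = ev-unique _ x≈0 λ k → trunc-trans (trunc-≈ (S-+ k b b′ x))
    (trunc-sym (trunc-+ (ev≈S b x≈0 ℕ.≤-refl) (ev≈S b′ x≈0 ℕ.≤-refl)))

  S-*ˡ : ∀ k r b x → S k (λ n → r * b n) x ≈ r * S k b x
  S-*ˡ zero    r b x = sym (zeroʳ r)
  S-*ˡ (suc k) r b x = trans (+-congˡ (*-congˡ (S-*ˡ k r (b ∘ suc) x)))
    (solve 4 (λ r b x s → r :* b :+ x :* (r :* s) := r :* (b :+ x :* s)) refl _ _ _ _)

  ev-*ˡ : ∀ r b {x} → x ≈[ 1 ] 0# → ev (λ n → r * b n) x ≈ r * ev b x
  ev-*ˡ r b {x} x≈0 = ev-unique _ x≈0 λ k → trunc-trans (trunc-≈ (S-*ˡ k r b x))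
    (trunc-* trunc-refl (trunc-sym (ev≈S b x≈0 ℕ.≤-refl)))

  S-scale : ∀ k r b x → S k (λ n → r ^ n * b n) x ≈ S k b (r * x)
  S-scale zero    r b x = refl
  S-scale (suc k) r b x = begin
    1# * b 0 + x * S k (λ n → r * r ^ n * b (suc n)) x
      ≈⟨ +-cong (*-identityˡ (b 0)) (*-congˡ (S-cong k (λ n → *-assoc r (r ^ n) (b (suc n))) refl)) ⟩
    b 0 + x * S k (λ n → r * (r ^ n * b (suc n))) x
      ≈⟨ +-congˡ (*-congˡ (trans (S-*ˡ k r _ x) (*-congˡ (S-scale k r (b ∘ suc) x)))) ⟩
    b 0 + x * (r * S k (b ∘ suc) (r * x))
      ≈⟨ solve 4 (λ b x r s → b :+ x :* (r :* s) := b :+ (r :* x) :* s) refl _ _ _ _ ⟩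
    b 0 + r * x * S k (b ∘ suc) (r * x) ∎

  trunc-*ʳ-0 : ∀ r {N x} → x ≈[ N ] 0# → r * x ≈[ N ] 0#
  trunc-*ʳ-0 r x≈0 = trunc-trans (trunc-* trunc-refl x≈0) (trunc-≈ (zeroʳ r))

  ev-scale : ∀ r b {x} → x ≈[ 1 ] 0# → ev (λ n → r ^ n * b n) x ≈ ev b (r * x)
  ev-scale r b {x} x≈0 = ev-unique _ x≈0 λ k → trunc-trans (trunc-≈ (S-scale k r b x))
    (trunc-sym (ev≈S b (trunc-*ʳ-0 r x≈0) ℕ.≤-refl))

  ^p-0 : 0# ^ p ≈ 0#
  ^p-0 = go p p≢0
    where
    go : ∀ n → NonZero n → 0# ^ n ≈ 0#
    go (suc n) _ = zeroˡ _

  ^p-≈0 : ∀ {x} → x ≈[ 1 ] 0# → x ^ p ≈[ 1 ] 0#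
  ^p-≈0 x≈0 = trunc-trans (trunc-^ p x≈0) (trunc-≈ ^p-0)

  S-frobenius : ∀ k b x → S k b x ^ p ≈ S k (λ n → b n ^ p) (x ^ p)
  S-frobenius zero    b x = ^p-0
  S-frobenius (suc k) b x = begin
    (b 0 + x * S k (b ∘ suc) x) ^ p            ≈⟨ frobenius-+ _ _ ⟩
    b 0 ^ p + (x * S k (b ∘ suc) x) ^ p        ≈⟨ +-congˡ (^-distrib-* x _ p) ⟩
    b 0 ^ p + x ^ p * S k (b ∘ suc) x ^ p      ≈⟨ +-congˡ (*-congˡ (S-frobenius k (b ∘ suc) x)) ⟩
    b 0 ^ p + x ^ p * S k (λ n → b (suc n) ^ p) (x ^ p) ∎

  ev-frobenius : ∀ b {x} → x ≈[ 1 ] 0# → ev b x ^ p ≈ ev (λ n → b n ^ p) (x ^ p)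
  ev-frobenius b {x} x≈0 = limit λ k → trunc-trans (trunc-^ p (ev≈S b x≈0 ℕ.≤-refl))
    (trunc-trans (trunc-≈ (S-frobenius k b x)) (trunc-sym (ev≈S _ (^p-≈0 x≈0) ℕ.≤-refl)))

  -- Comparing the two sides at x = πʲ modulo πʲ gives b₀; then divide by πʲ.
  ev-identity : ∀ {b b′} → (∀ j → ∃[ i ] j ℕ.≤ i × ev b (π ^ i) ≈ ev b′ (π ^ i)) → ∀ n → b n ≈ b′ n
  ev-identity {b} {b′} e n = go n b b′ λ j → large (e (suc j))
    where
    large : ∀ {b b′ j} → ∃[ i ] suc j ℕ.≤ i × ev b (π ^ i) ≈ ev b′ (π ^ i) → ∃[ i ] j ℕ.≤ i × ev b (π ^ suc i) ≈ ev b′ (π ^ suc i)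
    large (suc i , s≤s j≤i , e) = i , j≤i , e
    small : ∀ i → π ^ suc i ≈[ 1 ] 0#
    small i = coarsen (s≤s z≤n) (π^≈0 (suc i))
    constant-term : ∀ b b′ → (∀ j → ∃[ i ] j ℕ.≤ i × ev b (π ^ suc i) ≈ ev b′ (π ^ suc i)) → b 0 ≈ b′ 0
    constant-term b b′ e = limit λ N →
      let i , N≤i , eq = e N
          reduce : ∀ b → ev b (π ^ suc i) ≈[ N ] b 0
          reduce b = trunc-trans (trunc-≈ (ev-horner b (small i)))
            (trunc-trans (trunc-+ trunc-refl (trunc-* (coarsen (ℕ.m≤n⇒m≤1+n N≤i) (π^≈0 (suc i))) trunc-refl))
              (trunc-≈ (trans (+-congˡ (zeroˡ _)) (+-identityʳ _))))
      in trunc-trans (trunc-sym (reduce b)) (trunc-trans (trunc-≈ eq) (reduce b′))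
    go : ∀ n b b′ → (∀ j → ∃[ i ] j ℕ.≤ i × ev b (π ^ suc i) ≈ ev b′ (π ^ suc i)) → b n ≈ b′ n
    go zero    b b′ e = constant-term b b′ e
    go (suc n) b b′ e = go n (b ∘ suc) (b′ ∘ suc) λ j →
      let i , j≤i , eq = e j
      in i , j≤i , π^-cancel (suc i) (RingProperties.+-cancelˡ ring (b 0) _ _
           (trans (sym (ev-horner b (small i))) (trans eq (trans (ev-horner b′ (small i))
             (+-congʳ (sym (constant-term b b′ e)))))))

  infixl 9 _⟨_⟩
  -- Substitution of x for π: the coefficients are constants and stay as they are.
  _⟨_⟩ : R → R → R
  F ⟨ x ⟩ = ev (const ∘ F) x

  ⟨⟩-cong : ∀ {F G x y} → F ≈ G → x ≈ y → F ⟨ x ⟩ ≈ G ⟨ y ⟩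
  ⟨⟩-cong e = ev-cong (λ n → const-cong (at e n))

  π≈0 : π ≈[ 1 ] 0#
  π≈0 = trunc-1 (F.reflexive (≡.sym (𝟘-at 0)))

  S-π : ∀ k F → S k (const ∘ F) π ≈[ k ] F
  S-π zero    F = trunc-0
  S-π (suc k) F = trunc-trans (trunc-+ trunc-refl (trunc-*ˡ π≈0 (S-π k (tail F)))) (trunc-≈ (sym (horner F)))

  ⟨π⟩ : ∀ F → F ⟨ π ⟩ ≈ F
  ⟨π⟩ F = ev-unique _ π≈0 λ k → S-π k F

  *[1+π]-suc : ∀ F n → (F * (1# + π)) (suc n) F.≈ F (suc n) F.+ F n
  *[1+π]-suc F n = F.trans (at (trans (distribˡ F 1# π) (+-cong (*-identityʳ F) (*-comm F π))) (suc n))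
    (F.trans (F.reflexive (⊕-at F (π * F) (suc n))) (F.+-congˡ (π*-suc F n)))

  *[1+π]-zero : ∀ F → (F * (1# + π)) 0 F.≈ F 0
  *[1+π]-zero F = F.trans (at (trans (distribˡ F 1# π) (+-cong (*-identityʳ F) (*-comm F π))) 0)
    (F.trans (F.reflexive (⊕-at F (π * F) 0)) (F.trans (F.+-congˡ (π*-zero F)) (F.+-identityʳ _)))

  -- Substitution respects products; the case of the factor 1 + π follows directly from the
  -- recursion for the coefficients and is the one that twisting and the powers of 1 + π call for.
  *[1+π]-⟨⟩ : ∀ F {x} → x ≈[ 1 ] 0# → (F * (1# + π)) ⟨ x ⟩ ≈ F ⟨ x ⟩ * (1# + x)
  *[1+π]-⟨⟩ F {x} x≈0 = begin
    (F * (1# + π)) ⟨ x ⟩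
      ≈⟨ ev-horner _ x≈0 ⟩
    const ((F * (1# + π)) 0) + x * ev (λ n → const ((F * (1# + π)) (suc n))) x
      ≈⟨ +-cong (const-cong (*[1+π]-zero F)) (*-congˡ (trans (ev-cong (λ n → trans (const-cong (*[1+π]-suc F n)) (const-+ _ _)) refl)
           (ev-+ (const ∘ tail F) (const ∘ F) x≈0))) ⟩
    const (F 0) + x * (tail F ⟨ x ⟩ + F ⟨ x ⟩)
      ≈⟨ solve 4 (λ a x t f → a :+ x :* (t :+ f) := (a :+ x :* t) :+ f :* x) refl _ _ _ _ ⟩
    const (F 0) + x * tail F ⟨ x ⟩ + F ⟨ x ⟩ * x
      ≈⟨ +-congʳ (ev-horner (const ∘ F) x≈0) ⟨
    F ⟨ x ⟩ + F ⟨ x ⟩ * x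
      ≈⟨ trans (distribˡ _ _ _) (+-congʳ (*-identityʳ _)) ⟨
    F ⟨ x ⟩ * (1# + x) ∎

  1⟨⟩ : ∀ {x} → x ≈[ 1 ] 0# → 1# ⟨ x ⟩ ≈ 1#
  1⟨⟩ {x} x≈0 = trans (ev-horner (const ∘ const F.1#) x≈0)
    (trans (+-cong (const-cong F.refl) (trans (*-congˡ {x} zero-series) (zeroʳ x))) (+-identityʳ 1#))
    where
    S-const0 : ∀ k → S k (λ _ → const F.0#) x ≈ 0#
    S-const0 zero    = refl
    S-const0 (suc k) = trans (+-cong const-0 (trans (*-congˡ (S-const0 k)) (zeroʳ x))) (+-identityˡ 0#)
    zero-series : ev (λ _ → const F.0#) x ≈ 0#
    zero-series = ev-unique _ x≈0 λ k → trunc-≈ (S-const0 k)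

  [1+π]^-⟨⟩ : ∀ n {x} → x ≈[ 1 ] 0# → ((1# + π) ^ n) ⟨ x ⟩ ≈ (1# + x) ^ n
  [1+π]^-⟨⟩ zero    x≈0 = 1⟨⟩ x≈0
  [1+π]^-⟨⟩ (suc n) {x} x≈0 = trans (⟨⟩-cong (*-comm (1# + π) _) refl) (trans (*[1+π]-⟨⟩ ((1# + π) ^ n) x≈0)
    (trans (*-congʳ ([1+π]^-⟨⟩ n x≈0)) (*-comm _ _)))

  -- Multiplication by 1 + π is Pascal's rule.
  [1+π]^-at : ∀ n k → ((1# + π) ^ n) k F.≈ (n C k) F.⋆ F.1#
  [1+π]^-at zero    zero    = F.sym (F.+-identityʳ F.1#)
  [1+π]^-at zero    (suc k) = F.sym (F.×-congˡ {F.1#} (k>n⇒nCk≡0 {0} {suc k} (s≤s z≤n)))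
  [1+π]^-at (suc n) zero    = F.trans (at (*-comm (1# + π) _) 0) (F.trans (*[1+π]-zero _) ([1+π]^-at n zero))
  [1+π]^-at (suc n) (suc k) = F.trans (at (*-comm (1# + π) _) (suc k)) (F.trans (*[1+π]-suc _ k)
    (F.trans (F.+-cong ([1+π]^-at n (suc k)) ([1+π]^-at n k))
    (F.trans (F.+-comm _ _) (F.trans (F.sym (F.×-homo-+ F.1# (n C k) (n C suc k))) (F.×-congˡ (nCk+nC[k+1]≡[n+1]C[k+1] n k))))))

-- Formal characters of the group of 1-units.

module FormalCharacters {c ℓ : Level} {p : ℕ} (p-prime : Prime p) (𝔽 : FiniteField c ℓ p) where

  open Truncation p-prime 𝔽
  open Evaluation p-prime 𝔽

  -- F stands for the map 1 + x ↦ F(x), and (1 + x)(1 + y) = 1 + (x + y + x y). The law is imposed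
  -- on values over the whole maximal ideal, so that it can be tested at special points and pulled
  -- back through p-th powers.
  record IsCharacter (F : R) : Set (c ⊔ ℓ) where
    field
      normalised     : F 0 F.≈ F.1#
      multiplicative : ∀ {x y} → x ≈[ 1 ] 0# → y ≈[ 1 ] 0# → F ⟨ x ⟩ * F ⟨ y ⟩ ≈ F ⟨ x + y + x * y ⟩

  open IsCharacter

  -- The derivative of `S k b x` in x, obtained by the product rule from the Horner recursion.
  S′ : ℕ → (ℕ → R) → R → R
  S′ zero    b x = 0#
  S′ (suc k) b x = S k (b ∘ suc) x + x * S′ k (b ∘ suc) x

  taylor : ∀ {M} k b x {z} → z ≈[ M ] 0# → S k b (x + z) ≈[ M ℕ.+ M ] S k b x + z * S′ k b x
  taylor zero    b x {z} z≈0 = trunc-≈ (sym (trans (+-congˡ (zeroʳ z)) (+-identityʳ 0#)))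
  taylor {M} (suc k) b x {z} z≈0 = begin
    b 0 + (x + z) * S k (b ∘ suc) (x + z)
      ≈⟨ trunc-+ trunc-refl (trunc-* trunc-refl (taylor k (b ∘ suc) x z≈0)) ⟩
    b 0 + (x + z) * (s + z * t)
      ≈⟨ trunc-≈ (solve 5 (λ b x z s t → b :+ (x :+ z) :* (s :+ z :* t) := (b :+ x :* s :+ z :* (s :+ x :* t)) :+ z :* (z :* t)) refl _ _ _ _ _) ⟩
    (b 0 + x * s + z * (s + x * t)) + z * (z * t)
      ≈⟨ trunc-+ trunc-refl (trunc-*-0 z≈0 (trunc-trans (trunc-* z≈0 trunc-refl) (trunc-≈ (zeroˡ t)))) ⟩
    (b 0 + x * s + z * (s + x * t)) + 0#
      ≈⟨ trunc-≈ (+-identityʳ _) ⟩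
    b 0 + x * s + z * (s + x * t) ∎
    where
    open SetoidReasoning (truncSetoid (M ℕ.+ M))
    s = S k (b ∘ suc) x
    t = S′ k (b ∘ suc) x

  derivative : R → R
  derivative F n = suc n F.⋆ F (suc n)

  -- Differentiation loses one coefficient, whence `suc k` on the left.
  S′-π : ∀ k F → S′ (suc k) (const ∘ F) π ≈[ k ] derivative F
  S′-π zero    F = trunc-0
  S′-π (suc k) F = trunc-trans (trunc-+ (S-π (suc k) (tail F)) (trunc-*ˡ π≈0 (S′-π k (tail F)))) (trunc-≈ (pointwise λ where
    zero    → F.trans (F.reflexive (⊕-at (tail F) _ 0)) (F.+-congˡ (π*-zero _))
    (suc n) → F.trans (F.reflexive (⊕-at (tail F) _ (suc n))) (F.+-congˡ (π*-suc _ n))))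

  trunc-+-cancelˡ : ∀ {N} a {b d} → a + b ≈[ N ] a + d → b ≈[ N ] d
  trunc-+-cancelˡ a {b} {d} e = trunc λ n n<N → RingProperties.+-cancelˡ F.ring (a n) _ _
    (≡.subst₂ F._≈_ (⊕-at a b n) (⊕-at a d n) (below e n n<N))

  -- The coefficient of πⁿ in (1 + π) F′ = F₁ F, obtained from multiplicativity at
  -- x = π and y = πᴹ modulo π²ᴹ.
  differential-equation : ∀ {F} → IsCharacter F → ∀ n → F 1 F.* F n F.≈ suc n F.⋆ F (suc n) F.+ n F.⋆ F n
  differential-equation {F} χ n = F.trans (F.sym (F.trans (at (*-comm F (const (F 1))) n) (const-⊗ (F 1) F n)))
    (F.trans (below compare n (ℕ.m≤n⇒m≤1+n (ℕ.n<1+n n))) (coefficient n))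
    where
    -- M exceeds n, and as a double successor it lets the partial sum of length M + M unfold to F₀ +
    -- y (F₁ + y ...), which exposes the linear term.
    M = suc (suc n)
    y = π ^ M
    y≈0 : y ≈[ M ] 0#
    y≈0 = π^≈0 M
    y≈0₁ : y ≈[ 1 ] 0#
    y≈0₁ = coarsen (s≤s z≤n) y≈0
    D = derivative F
    lhs : F ⟨ π ⟩ * F ⟨ y ⟩ ≈[ M ℕ.+ M ] F + y * (F * const (F 1))
    lhs = trunc-trans
      (trunc-* (trunc-≈ (⟨π⟩ F))
        (trunc-trans (ev≈S (const ∘ F) y≈0₁ ℕ.≤-refl)
          (trunc-+ (trunc-≈ (const-cong (normalised χ)))
            (trunc-*ˡ y≈0 (trunc-trans (trunc-+ trunc-refl (trunc-trans (trunc-* y≈0 trunc-refl) (trunc-≈ (zeroˡ _)))) (trunc-≈ (+-identityʳ _)))))))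
      (trunc-≈ (solve 3 (λ f y c → f :* (con 1 :+ y :* c) := f :+ y :* (f :* c)) refl F y (const (F 1))))
    -- The increment from π to π + y + π y is z = (1 + π) y; its square vanishes modulo π^(2M), so a
    -- first-order expansion is exact there. The factor 1 + π of the differential equation
    -- originates here.
    z = y + π * y
    z≈0 : z ≈[ M ] 0#
    z≈0 = trunc-trans (trunc-+ y≈0 (trunc-*ʳ-0 π y≈0)) (trunc-≈ (+-identityʳ 0#))
    π+z≈0 : π + z ≈[ 1 ] 0#
    π+z≈0 = trunc-trans (trunc-+ π≈0 (coarsen (s≤s z≤n) z≈0)) (trunc-≈ (+-identityʳ 0#))
    rhs : F ⟨ π + y + π * y ⟩ ≈[ M ℕ.+ M ] F + y * (D + π * D)
    rhs = trunc-trans (trunc-≈ (⟨⟩-cong refl (+-assoc π y (π * y))))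
      (trunc-trans (ev≈S (const ∘ F) π+z≈0 (ℕ.n≤1+n (M ℕ.+ M)))
      (trunc-trans (taylor (suc (M ℕ.+ M)) (const ∘ F) π z≈0)
      (trunc-trans (trunc-+ (coarsen (ℕ.n≤1+n _) (S-π (suc (M ℕ.+ M)) F)) (trunc-* trunc-refl (S′-π (M ℕ.+ M) F)))
        (trunc-≈ (solve 4 (λ f y π d → f :+ (y :+ π :* y) :* d := f :+ y :* (d :+ π :* d)) refl F y π D)))))
    compare : F * const (F 1) ≈[ M ] D + π * D
    compare = trunc-π^-cancel M (trunc-+-cancelˡ F
      (trunc-trans (trunc-sym lhs) (trunc-trans (trunc-≈ (multiplicative χ π≈0 y≈0₁)) rhs)))
    coefficient : ∀ n → (D + π * D) n F.≈ suc n F.⋆ F (suc n) F.+ n F.⋆ F n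
    coefficient zero    = F.trans (F.reflexive (⊕-at D _ 0)) (F.+-congˡ (π*-zero D))
    coefficient (suc n) = F.trans (F.reflexive (⊕-at D _ (suc n))) (F.+-congˡ (π*-suc D n))

  -- Otherwise the differential equation shows inductively that F₀, …, Fₚ₋₁ and p Fₚ are all nonzero.
  F₁∈𝔽ₚ : ∀ {F} → IsCharacter F → ∃[ n ] n ℕ.≤ p × F 1 F.≈ n F.⋆ F.1#
  F₁∈𝔽ₚ {F} χ = search (ℕ.pred p) 0 (≡.trans (ℕ.+-comm _ 1) (ℕ.suc-pred p)) λ F₀≈0 → F.0≉1 (F.trans (F.sym F₀≈0) (normalised χ))
    where
    [F₁-n]Fₙ : ∀ n → (F 1 F.- n F.⋆ F.1#) F.* F n F.≈ suc n F.⋆ F (suc n)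
    [F₁-n]Fₙ n = RingProperties.+-cancelʳ F.ring (n F.⋆ F n) _ _ (begin
      (F 1 F.- n F.⋆ F.1#) F.* F n F.+ n F.⋆ F n              ≈⟨ F.+-congˡ (n⋆x≈[n⋆1]x n (F n)) ⟩
      (F 1 F.- n F.⋆ F.1#) F.* F n F.+ n F.⋆ F.1# F.* F n     ≈⟨ F.distribʳ _ _ _ ⟨
      (F 1 F.- n F.⋆ F.1# F.+ n F.⋆ F.1#) F.* F n             ≈⟨ F.*-congʳ (F.trans (F.+-assoc _ _ _) (F.trans (F.+-congˡ (F.-‿inverseˡ _)) (F.+-identityʳ _))) ⟩
      F 1 F.* F n                                             ≈⟨ differential-equation χ n ⟩
      suc n F.⋆ F (suc n) F.+ n F.⋆ F n                       ∎)
      where open SetoidReasoning F.setoid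
    nonzero : ∀ n → ¬ (F n F.≈ F.0#) → ¬ (F 1 F.≈ n F.⋆ F.1#) → ¬ (suc n F.⋆ F (suc n) F.≈ F.0#)
    nonzero n Fₙ≉0 F₁≉n e = Fₙ≉0 (xy≈0⇒y≈0 (λ d → F₁≉n (x-y≈0⇒x≈y d)) (F.trans ([F₁-n]Fₙ n) e))
    search : ∀ fuel n → fuel ℕ.+ suc n ≡ p → ¬ (F n F.≈ F.0#) → ∃[ n ] n ℕ.≤ p × F 1 F.≈ n F.⋆ F.1#
    search fuel n fuel+n≡p Fₙ≉0 with F 1 ≟ n F.⋆ F.1#
    search fuel n fuel+n≡p Fₙ≉0 | yes e = n , subst (n ℕ.≤_) fuel+n≡p (ℕ.≤-trans (ℕ.n≤1+n n) (ℕ.m≤n+m (suc n) fuel)) , e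
    search zero n 1+n≡p Fₙ≉0 | no F₁≉n = contradiction
      (F.p∣n⇒n⋆≈0 F.characteristic (divides 1 (≡.trans 1+n≡p (≡.sym (ℕ.*-identityˡ p)))) (F (suc n)))
      (nonzero n Fₙ≉0 F₁≉n)
    search (suc fuel) n e Fₙ≉0 | no F₁≉n = search fuel (suc n) (≡.trans (ℕ.+-suc fuel (suc n)) e) λ Fₙ₊₁≈0 →
      nonzero n Fₙ≉0 F₁≉n (F.trans (n⋆x≈[n⋆1]x (suc n) _) (F.trans (F.*-congˡ Fₙ₊₁≈0) (F.zeroʳ _)))

  digit : ∀ {F} → IsCharacter F → ∃[ e ] F 1 F.+ e F.⋆ F.1# F.≈ F.0#
  digit χ = let n , n≤p , F₁≈n = F₁∈𝔽ₚ χ in p ℕ.∸ n ,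
    F.trans (F.+-congʳ F₁≈n) (F.trans (F.sym (F.×-homo-+ F.1# n (p ℕ.∸ n)))
      (F.trans (F.×-congˡ (ℕ.m+[n∸m]≡n n≤p)) F.characteristic))

  x+y+xy≈0 : ∀ {x y} → x ≈[ 1 ] 0# → y ≈[ 1 ] 0# → x + y + x * y ≈[ 1 ] 0#
  x+y+xy≈0 {x} x≈0 y≈0 = trunc-trans (trunc-+ (trunc-+ x≈0 y≈0) (trunc-*ʳ-0 x y≈0))
    (trunc-≈ (trans (+-identityʳ _) (+-identityʳ 0#)))

  -- 1 + π is the series of the identity map u ↦ u, so this is the product of two homomorphisms into
  -- a commutative group.
  twist : ∀ {F} → IsCharacter F → IsCharacter (F * (1# + π))
  twist {F} χ = record
    { normalised     = F.trans (*[1+π]-zero F) (normalised χ)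
    ; multiplicative = λ {x} {y} x≈0 y≈0 → begin
        (F * (1# + π)) ⟨ x ⟩ * (F * (1# + π)) ⟨ y ⟩
          ≈⟨ *-cong (*[1+π]-⟨⟩ F x≈0) (*[1+π]-⟨⟩ F y≈0) ⟩
        F ⟨ x ⟩ * (1# + x) * (F ⟨ y ⟩ * (1# + y))
          ≈⟨ solve 4 (λ f g x y → f :* (con 1 :+ x) :* (g :* (con 1 :+ y)) := f :* g :* (con 1 :+ (x :+ y :+ x :* y))) refl _ _ x y ⟩
        F ⟨ x ⟩ * F ⟨ y ⟩ * (1# + (x + y + x * y))
          ≈⟨ *-congʳ (multiplicative χ x≈0 y≈0) ⟩
        F ⟨ x + y + x * y ⟩ * (1# + (x + y + x * y))
          ≈⟨ *[1+π]-⟨⟩ F (x+y+xy≈0 x≈0 y≈0) ⟨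
        (F * (1# + π)) ⟨ x + y + x * y ⟩ ∎
    }
    where
    open SetoidReasoning setoid

  twist-1 : ∀ {F} → IsCharacter F → (F * (1# + π)) 1 F.≈ F 1 F.+ F.1#
  twist-1 {F} χ = F.trans (*[1+π]-suc F 0) (F.+-congˡ (normalised χ))

  cong-character : ∀ {F G} → F ≈ G → IsCharacter F → IsCharacter G
  cong-character e χ = record
    { normalised     = F.trans (F.sym (at e 0)) (normalised χ)
    ; multiplicative = λ x≈0 y≈0 → trans (sym (*-cong (⟨⟩-cong e refl) (⟨⟩-cong e refl)))
                         (trans (multiplicative χ x≈0 y≈0) (⟨⟩-cong e refl))
    }

  twist^ : ∀ e {F} → IsCharacter F → IsCharacter (F * (1# + π) ^ e) × (F * (1# + π) ^ e) 1 F.≈ F 1 F.+ e F.⋆ F.1#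
  twist^ zero    {F} χ = cong-character (sym (*-identityʳ F)) χ , F.trans (at (*-identityʳ F) 1) (F.sym (F.+-identityʳ _))
  twist^ (suc e) {F} χ = let χ′ , G₁ = twist^ e (twist χ) in
    cong-character (*-assoc F _ _) χ′ ,
    F.trans (F.sym (at (*-assoc F (1# + π) _) 1)) (F.trans G₁ (F.trans (F.+-congʳ (twist-1 χ)) (F.+-assoc _ _ _)))

  -- The argument z with 1 + z = (1 + x)ⁿ is built along with the power by the law x + y + x y,
  -- which keeps it in the maximal ideal.
  character-^ : ∀ {F} → IsCharacter F → ∀ n {x} → x ≈[ 1 ] 0# →
                ∃[ z ] z ≈[ 1 ] 0# × 1# + z ≈ (1# + x) ^ n × F ⟨ x ⟩ ^ n ≈ F ⟨ z ⟩
  character-^ {F} χ zero    x≈0 = 0# , trunc-refl , +-identityʳ 1# ,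
    sym (trans (ev-horner (const ∘ F) trunc-refl) (trans (+-cong (const-cong (normalised χ)) (zeroˡ _)) (+-identityʳ 1#)))
  character-^ {F} χ (suc n) {x} x≈0 = let z , z≈0 , 1+z , Fz = character-^ χ n x≈0 in
    x + z + x * z ,
    x+y+xy≈0 x≈0 z≈0 ,
    trans (solve 2 (λ x z → con 1 :+ (x :+ z :+ x :* z) := (con 1 :+ x) :* (con 1 :+ z)) refl x z) (*-congˡ 1+z) ,
    trans (*-congˡ Fz) (multiplicative χ x≈0 z≈0)

  character-frobenius : ∀ {F} → IsCharacter F → ∀ {x} → x ≈[ 1 ] 0# → F ⟨ x ⟩ ^ p ≈ F ⟨ x ^ p ⟩
  character-frobenius χ {x} x≈0 = let z , z≈0 , 1+z , Fz = character-^ χ p x≈0 in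
    trans Fz (⟨⟩-cong refl (RingProperties.+-cancelˡ ring 1# _ _
      (trans 1+z (trans (frobenius-+ 1# x) (+-congʳ (1^ p))))))

  ⟨⟩-frobenius : ∀ {F} → (∀ n → F n F.^ p F.≈ F n) → ∀ {x} → x ≈[ 1 ] 0# → F ⟨ x ⟩ ^ p ≈ F ⟨ x ^ p ⟩
  ⟨⟩-frobenius {F} fixed x≈0 = trans (ev-frobenius (const ∘ F) x≈0)
    (ev-cong (λ n → trans (sym (const-^ (F n) p)) (const-cong (fixed n))) refl)

  -- F(x)ᵖ = F(xᵖ) equates the series Σ Fₙᵖ tⁿ and Σ Fₙ tⁿ at t = xᵖ. The choice x = π^(j+1)
  -- supplies such t of arbitrarily high valuation, which determines the coefficients.
  coefficients-fixed : ∀ {F} → IsCharacter F → ∀ n → F n F.^ p F.≈ F n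
  coefficients-fixed {F} χ n = at (trans (const-^ (F n) p) (ev-identity {λ n → const (F n) ^ p} {const ∘ F} points n)) 0
    where
    points : ∀ j → ∃[ i ] j ℕ.≤ i × ev (λ n → const (F n) ^ p) (π ^ i) ≈ F ⟨ π ^ i ⟩
    points j = suc j ℕ.* p , ℕ.≤-trans (ℕ.n≤1+n j) (ℕ.m≤m*n (suc j) p) ,
      trans (ev-cong (λ _ → refl) (sym (^-assocʳ π (suc j) p)))
        (trans (sym (ev-frobenius (const ∘ F) small)) (trans (character-frobenius χ small) (⟨⟩-cong refl (^-assocʳ π (suc j) p))))
      where
      small : π ^ suc j ≈[ 1 ] 0#
      small = coarsen (s≤s z≤n) (π^≈0 (suc j))

  S-split : ∀ m n b x → S (m ℕ.+ n) b x ≈ S m b x + x ^ m * S n (λ i → b (m ℕ.+ i)) x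
  S-split zero    n b x = sym (trans (+-identityˡ _) (*-identityˡ _))
  S-split (suc m) n b x = trans (+-congˡ (*-congˡ (S-split m n (b ∘ suc) x)))
    (solve 5 (λ b x s y t → b :+ x :* (s :+ y :* t) := (b :+ x :* s) :+ (x :* y) :* t) refl _ _ _ _ _)

  S-zero : ∀ k {b} x → (∀ j → j ℕ.< k → b j ≈ 0#) → S k b x ≈ 0#
  S-zero zero    x e = refl
  S-zero (suc k) x e = trans (+-cong (e 0 (s≤s z≤n)) (trans (*-congˡ (S-zero k x λ j j<k → e (suc j) (s≤s j<k))) (zeroʳ x))) (+-identityˡ 0#)

  S-const : ∀ k .{{_ : NonZero k}} {b} x → (∀ j → suc j ℕ.< k → b (suc j) ≈ 0#) → S k b x ≈ b 0
  S-const (suc k) x e = trans (+-congˡ (trans (*-congˡ (S-zero k x λ j j<k → e j (s≤s j<k))) (zeroʳ x))) (+-identityʳ _)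

  -- The sum is cut into blocks of length p, each of which keeps only its first term.
  S-sparse : ∀ k b x → (∀ n j → suc j ℕ.< p → b (n ℕ.* p ℕ.+ suc j) ≈ 0#) → S (k ℕ.* p) b x ≈ S k (λ n → b (n ℕ.* p)) (x ^ p)
  S-sparse zero    b x e = refl
  S-sparse (suc k) b x e = begin
    S (p ℕ.+ k ℕ.* p) b x
      ≈⟨ S-split p (k ℕ.* p) b x ⟩
    S p b x + x ^ p * S (k ℕ.* p) (λ i → b (p ℕ.+ i)) x
      ≈⟨ +-cong (S-const p x (e 0)) (*-congˡ (S-sparse k (λ i → b (p ℕ.+ i)) x
           λ n j j<p → trans (reflexive (cong b (≡.sym (ℕ.+-assoc p (n ℕ.* p) (suc j))))) (e (suc n) j j<p))) ⟩
    b 0 + x ^ p * S k (λ n → b (p ℕ.+ n ℕ.* p)) (x ^ p) ∎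
    where open SetoidReasoning setoid

  ev-sparse : ∀ b {x} → x ≈[ 1 ] 0# → (∀ n j → suc j ℕ.< p → b (n ℕ.* p ℕ.+ suc j) ≈ 0#) → ev b x ≈ ev (λ n → b (n ℕ.* p)) (x ^ p)
  ev-sparse b {x} x≈0 e = limit λ k → trunc-trans (ev≈S b x≈0 (ℕ.m≤m*n k p))
    (trunc-trans (trunc-≈ (S-sparse k b x e)) (trunc-sym (ev≈S _ (^p-≈0 x≈0) ℕ.≤-refl)))

  module _ {G : R} (χ : IsCharacter G) (G₁≈0 : G 1 F.≈ F.0#) where

    -- With G₁ = 0 the differential equation reads (n + 1) Gₙ₊₁ + n Gₙ = 0, so the vanishing
    -- propagates from n = 0.
    nGₙ≈0 : ∀ n → n F.⋆ G n F.≈ F.0#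
    nGₙ≈0 zero    = F.refl
    nGₙ≈0 (suc n) = begin
      suc n F.⋆ G (suc n)               ≈⟨ F.+-identityʳ _ ⟨
      suc n F.⋆ G (suc n) F.+ F.0#      ≈⟨ F.+-congˡ (nGₙ≈0 n) ⟨
      suc n F.⋆ G (suc n) F.+ n F.⋆ G n ≈⟨ differential-equation χ n ⟨
      G 1 F.* G n                       ≈⟨ F.trans (F.*-congʳ G₁≈0) (F.zeroˡ _) ⟩
      F.0#                              ∎
      where open SetoidReasoning F.setoid

    sparse : ∀ n j → suc j ℕ.< p → G (n ℕ.* p ℕ.+ suc j) F.≈ F.0#
    sparse n j j<p = xy≈0⇒y≈0 (0<n<p⇒n⋆1≉0 j<p)
      (F.trans (F.*-congʳ (F.sym ([np+j]⋆1≈j⋆1 n (suc j)))) (F.trans (F.sym (n⋆x≈[n⋆1]x (n ℕ.* p ℕ.+ suc j) _)) (nGₙ≈0 (n ℕ.* p ℕ.+ suc j))))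

    -- A p-th root of G, which is supported on multiples of p. Its coefficients are those of G
    -- unchanged, because Frobenius fixes them.
    root : R
    root n = G (n ℕ.* p)

    root-^p : ∀ {x} → x ≈[ 1 ] 0# → root ⟨ x ⟩ ^ p ≈ G ⟨ x ⟩
    root-^p x≈0 = trans (⟨⟩-frobenius (λ n → coefficients-fixed χ (n ℕ.* p)) x≈0)
      (sym (ev-sparse (const ∘ G) x≈0 λ n j j<p → trans (const-cong (sparse n j j<p)) const-0))

    -- The law for G is an identity between p-th powers, and Frobenius is injective on 𝔽[[π]].
    root-character : IsCharacter root
    root-character = record
      { normalised     = normalised χ
      ; multiplicative = λ {x} {y} x≈0 y≈0 → frobeniusR-injective (begin
          (root ⟨ x ⟩ * root ⟨ y ⟩) ^ p       ≈⟨ ^-distrib-* _ _ p ⟩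
          root ⟨ x ⟩ ^ p * root ⟨ y ⟩ ^ p     ≈⟨ *-cong (root-^p x≈0) (root-^p y≈0) ⟩
          G ⟨ x ⟩ * G ⟨ y ⟩                   ≈⟨ multiplicative χ x≈0 y≈0 ⟩
          G ⟨ x + y + x * y ⟩                 ≈⟨ root-^p (x+y+xy≈0 x≈0 y≈0) ⟨
          root ⟨ x + y + x * y ⟩ ^ p          ∎)
      }
      where open SetoidReasoning setoid

  Character : Set (c ⊔ ℓ)
  Character = ∃[ F ] IsCharacter F

  step : (χ : Character) → ∃[ e ] Σ[ χ′ ∈ Character ] proj₁ χ * (1# + π) ^ e ≈ proj₁ χ′ ^ p
  step (F , χ) = let e , F₁+e≈0 = digit χ
                     χ′ , G₁ = twist^ e χ
                     G₁≈0 = F.trans G₁ F₁+e≈0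
                     H = root χ′ G₁≈0
    in e , (H , root-character χ′ G₁≈0) ,
       -- Evaluation at x = π turns the identity between values into one between series.
       trans (sym (⟨π⟩ _)) (trans (sym (root-^p χ′ G₁≈0 π≈0)) (^-congˡ p (⟨π⟩ H)))

  iterates : Character → ℕ → Character
  iterates χ zero    = χ
  iterates χ (suc k) = proj₁ (proj₂ (step (iterates χ k)))

  -- The digits are not normalised: a vanishing linear coefficient yields the digit p. Consecutive
  -- values still agree modulo p^k, which is what a p-adic limit asks for.
  exponent : Character → ℕ → ℕ
  exponent χ zero    = 0
  exponent χ (suc k) = exponent χ k ℕ.+ proj₁ (step (iterates χ k)) ℕ.* p ℕ.^ k

  iterates-^ : ∀ χ k → proj₁ χ * (1# + π) ^ exponent χ k ≈ proj₁ (iterates χ k) ^ (p ℕ.^ k)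
  iterates-^ χ zero    = refl
  iterates-^ χ (suc k) = begin
    F * u ^ (a ℕ.+ e ℕ.* q)               ≈⟨ *-congˡ (trans (^-homo-* u a (e ℕ.* q)) (*-congˡ (sym (^-assocʳ u e q)))) ⟩
    F * (u ^ a * (u ^ e) ^ q)             ≈⟨ *-assoc _ _ _ ⟨
    F * u ^ a * (u ^ e) ^ q               ≈⟨ *-congʳ (iterates-^ χ k) ⟩
    Fₖ ^ q * (u ^ e) ^ q                  ≈⟨ ^-distrib-* Fₖ (u ^ e) q ⟨
    (Fₖ * u ^ e) ^ q                      ≈⟨ ^-congˡ q (proj₂ (proj₂ (step (iterates χ k)))) ⟩
    (Fₖ₊₁ ^ p) ^ q                        ≈⟨ ^-assocʳ Fₖ₊₁ p q ⟩
    Fₖ₊₁ ^ (p ℕ.* q)                      ∎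
    where
    open SetoidReasoning setoid
    F = proj₁ χ
    Fₖ = proj₁ (iterates χ k)
    Fₖ₊₁ = proj₁ (iterates χ (suc k))
    u = 1# + π
    a = exponent χ k
    e = proj₁ (step (iterates χ k))
    q = p ℕ.^ k

-- Powers of 1-units with p-adic exponents.

∣ᶻ⇒≡+ : ∀ m a b → + m ∣ᶻ + a ℤ.- + b → (∃[ j ] a ≡ b ℕ.+ j ℕ.* m) ⊎ (∃[ j ] b ≡ a ℕ.+ j ℕ.* m)
∣ᶻ⇒≡+ m a b d with ℕ.≤-total b a
... | inj₁ b≤a with subst (λ t → m ∣ ℤ.∣ t ∣) (≡.trans (ℤ.m-n≡m⊖n a b) (ℤ.⊖-≥ b≤a)) (∣⇒∣ᵤ d)
...   | divides j e = inj₁ (j , ≡.trans (≡.sym (ℕ.m+[n∸m]≡n b≤a)) (cong (b ℕ.+_) e))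
∣ᶻ⇒≡+ m a b d | inj₂ a≤b with subst (m ∣_) (≡.trans (cong ℤ.∣_∣ (ℤ.m-n≡m⊖n a b)) (ℤ.∣⊖∣-≤ a≤b)) (∣⇒∣ᵤ d)
...   | divides j e = inj₂ (j , ≡.trans (≡.sym (ℕ.m+[n∸m]≡n a≤b)) (cong (a ℕ.+_) e))

∣ᶻ-sub-trans : ∀ {m} a b d → m ∣ᶻ a ℤ.- b → m ∣ᶻ b ℤ.- d → m ∣ᶻ a ℤ.- d
∣ᶻ-sub-trans a b d e f = subst (_ ∣ᶻ_)
  (solve 3 (λ a b d → (a :- b) :+ (b :- d) := a :- d) ≡.refl a b d) (∣m∣n⇒∣m+n e f)
  where open ℤSolver.+-*-Solver

∣ᶻ-sub-sym : ∀ {m} a b → m ∣ᶻ a ℤ.- b → m ∣ᶻ b ℤ.- a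
∣ᶻ-sub-sym a b e = subst (_ ∣ᶻ_) (solve 2 (λ a b → :- (a :- b) := b :- a) ≡.refl a b) (∣m⇒∣-m e)
  where open ℤSolver.+-*-Solver

i+j-i≡j : ∀ i j → i ℤ.+ j ℤ.- i ≡ j
i+j-i≡j = solve 2 (λ i j → i :+ j :- i := j) ≡.refl
  where open ℤSolver.+-*-Solver

[i-k]+[j-l]≡[i+j]-[k+l] : ∀ i j k l → (i ℤ.- k) ℤ.+ (j ℤ.- l) ≡ i ℤ.+ j ℤ.- (k ℤ.+ l)
[i-k]+[j-l]≡[i+j]-[k+l] = solve 4 (λ i j k l → (i :- k) :+ (j :- l) := (i :+ j) :- (k :+ l)) ≡.refl
  where open ℤSolver.+-*-Solver

module Powers {c ℓ : Level} {p : ℕ} (p-prime : Prime p) (𝔽 : FiniteField c ℓ p) where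

  open Truncation p-prime 𝔽
  open Evaluation p-prime 𝔽
  open FormalCharacters p-prime 𝔽
  open OneUnits p-prime 𝔽 using (residue; residue-coherent; binom; reduce)

  k<p^k : ∀ k → k ℕ.< p ℕ.^ k
  k<p^k zero    = s≤s z≤n
  k<p^k (suc k) = ℕ.≤-<-trans (k<p^k k) (subst (p ℕ.^ k ℕ.<_) (ℕ.*-comm (p ℕ.^ k) p)
    (ℕ.m<m*n (p ℕ.^ k) p {{ℕ.m^n≢0 p k}} (ℕ.nonTrivial⇒n>1 p {{prime⇒nonTrivial p-prime}})))

  residue≡approx : ∀ y k → + (p ℕ.^ k) ∣ᶻ + residue y k ℤ.- approx y k
  residue≡approx y k = ∣ᶻ-sub-sym (approx y k) (+ residue y k) (divides t
    (≡.trans (cong (ℤ._- + residue y k) (a≡a%ℕn+[a/ℕn]*n (approx y k) (p ℕ.^ k) {{ℕ.m^n≢0 p k}}))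
      (i+j-i≡j (+ residue y k) (t ℤ.* + (p ℕ.^ k)))))
    where
    t = (approx y k /ℕ (p ℕ.^ k)) {{ℕ.m^n≢0 p k}}

  residue-coherent-+ : ∀ y k j → + (p ℕ.^ k) ∣ᶻ + residue y (j ℕ.+ k) ℤ.- + residue y k
  residue-coherent-+ y k zero    = divides (+ 0) (ℤ.+-inverseʳ (+ residue y k))
  residue-coherent-+ y k (suc j) = ∣ᶻ-sub-trans (+ residue y (suc j ℕ.+ k)) (+ residue y (j ℕ.+ k)) (+ residue y k)
    (∣ᶻ-trans (∣ᵤ⇒∣ (≤⇒^∣^ p (ℕ.m≤n+m k j))) (residue-coherent y (j ℕ.+ k))) (residue-coherent-+ y k j)

  residue-coherent-≤ : ∀ y {k l} → k ℕ.≤ l → + (p ℕ.^ k) ∣ᶻ + residue y l ℤ.- + residue y k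
  residue-coherent-≤ y {k} {l} k≤l = subst (λ t → + (p ℕ.^ k) ∣ᶻ + residue y t ℤ.- + residue y k)
    (ℕ.m∸n+n≡m k≤l) (residue-coherent-+ y k (l ℕ.∸ k))

  unit-decompose : ∀ {u} → u ≈[ 1 ] 1# → u - 1# ≈[ 1 ] 0#
  unit-decompose u≈1 = trunc-trans (trunc-+ u≈1 trunc-refl) (trunc-≈ (-‿inverseʳ 1#))

  1+[u-1]≈u : ∀ u → 1# + (u - 1#) ≈ u
  1+[u-1]≈u u = trans (+-comm 1# _) (trans (+-assoc u (- 1#) 1#) (trans (+-congˡ (-‿inverseˡ 1#)) (+-identityʳ u)))

  -- (1 + x)^(p^k) = 1 + x^(p^k), and x has no constant term.
  unit-^p^k : ∀ k {u} → u ≈[ 1 ] 1# → u ^ (p ℕ.^ k) ≈[ p ℕ.^ k ] 1#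
  unit-^p^k k {u} u≈1 = trunc-trans (trunc-≈ (trans (^-congˡ q (sym (1+[u-1]≈u u))) (freshman^ charℛ p-prime k 1# (u - 1#))))
    (trunc-trans (trunc-+ (trunc-≈ (1^ q)) (trunc-^-0 q (unit-decompose u≈1))) (trunc-≈ (+-identityʳ 1#)))
    where q = p ℕ.^ k

  unit-^-periodic : ∀ k {u} → u ≈[ 1 ] 1# → ∀ a j → u ^ (a ℕ.+ j ℕ.* p ℕ.^ k) ≈[ p ℕ.^ k ] u ^ a
  unit-^-periodic k {u} u≈1 a j = trunc-trans (trunc-≈ (trans (^-homo-* u a (j ℕ.* q))
      (*-congˡ (trans (^-congʳ u (ℕ.*-comm j q)) (sym (^-assocʳ u q j))))))
    (trunc-trans (trunc-* trunc-refl (trunc-trans (trunc-^ j (unit-^p^k k u≈1)) (trunc-≈ (1^ j)))) (trunc-≈ (*-identityʳ _)))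
    where q = p ℕ.^ k

  unit-^-cong : ∀ k {u} → u ≈[ 1 ] 1# → ∀ a b → + (p ℕ.^ k) ∣ᶻ + a ℤ.- + b → u ^ a ≈[ p ℕ.^ k ] u ^ b
  unit-^-cong k u≈1 a b d with ∣ᶻ⇒≡+ (p ℕ.^ k) a b d
  ... | inj₁ (j , ≡.refl) = unit-^-periodic k u≈1 b j
  ... | inj₂ (j , ≡.refl) = trunc-sym (unit-^-periodic k u≈1 a j)

  opaque

    -- n < p^(n+1), so the n-th coefficient of uᵃ depends only on a modulo p^(n+1).
    infixr 8 _^ₚ_
    _^ₚ_ : R → ℤₚ p → R
    (u ^ₚ y) n = (u ^ residue y (suc n)) n

    -- Coefficient n is computed with y modulo p^(n+1), the right-hand side with y modulo p^k. The
    -- two residues agree modulo the smaller of these powers, and n lies below it in either case.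
    ^ₚ-residue : ∀ {u} y k → u ≈[ 1 ] 1# → u ^ₚ y ≈[ p ℕ.^ k ] u ^ residue y k
    ^ₚ-residue {u} y k u≈1 = trunc go
      where
      go : ∀ n → n ℕ.< p ℕ.^ k → (u ^ residue y (suc n)) n F.≈ (u ^ residue y k) n
      go n n<p^k with ℕ.≤-total k (suc n)
      ... | inj₁ k≤n = below (unit-^-cong k u≈1 (residue y (suc n)) (residue y k) (residue-coherent-≤ y k≤n)) n n<p^k
      ... | inj₂ n≤k = F.sym (below (unit-^-cong (suc n) u≈1 (residue y k) (residue y (suc n)) (residue-coherent-≤ y n≤k)) n (ℕ.<-trans (ℕ.n<1+n n) (k<p^k (suc n))))

    trunc-^ₚ : ∀ {N u v} y → u ≈[ N ] v → u ^ₚ y ≈[ N ] v ^ₚ y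
    trunc-^ₚ y u≈v = trunc λ n n<N → below (trunc-^ (residue y (suc n)) u≈v) n n<N

    -- Modulo p, `binom y n` is read off from y modulo p^(1+n), the very residue r that `_^ₚ_` uses
    -- for coefficient n; both sides are therefore C(r,n) in 𝔽.
    reduce-binom : ∀ y n → reduce (binom y n) F.≈ ((1# + π) ^ₚ y) n
    reduce-binom y n = F.trans (⋆1-cong (∣ᶻ⇒≡+ (p ℕ.^ 1) (residue (binom y n) 1) (residue y (suc n) C n) (residue≡approx (binom y n) 1)))
      (F.sym ([1+π]^-at (residue y (suc n)) n))
      where
      shift-⋆ : ∀ b j → (b ℕ.+ j ℕ.* p ℕ.^ 1) F.⋆ F.1# F.≈ b F.⋆ F.1#
      shift-⋆ b j = F.trans (F.×-homo-+ F.1# b (j ℕ.* p ℕ.^ 1)) (F.trans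
        (F.+-congˡ (F.p∣n⇒n⋆≈0 F.characteristic (divides j (cong (j ℕ.*_) (ℕ.*-identityʳ p))) F.1#)) (F.+-identityʳ _))
      ⋆1-cong : ∀ {a b} → (∃[ j ] a ≡ b ℕ.+ j ℕ.* p ℕ.^ 1) ⊎ (∃[ j ] b ≡ a ℕ.+ j ℕ.* p ℕ.^ 1) → a F.⋆ F.1# F.≈ b F.⋆ F.1#
      ⋆1-cong {b = b} (inj₁ (j , ≡.refl)) = shift-⋆ b j
      ⋆1-cong {a = a} (inj₂ (j , ≡.refl)) = F.sym (shift-⋆ a j)

  ^ₚ-approx : ∀ {u} y k a → u ≈[ 1 ] 1# → + (p ℕ.^ k) ∣ᶻ + a ℤ.- approx y k → u ^ₚ y ≈[ p ℕ.^ k ] u ^ a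
  ^ₚ-approx y k a u≈1 d = trunc-trans (^ₚ-residue y k u≈1) (unit-^-cong k u≈1 (residue y k) a
    (∣ᶻ-sub-trans (+ residue y k) (approx y k) (+ a) (residue≡approx y k) (∣ᶻ-sub-sym (+ a) (approx y k) d)))

  -- k < p^k makes these moduli cofinal, and they are the ones at which a p-adic exponent may be
  -- replaced by a natural number.
  limit^ : ∀ {a b} → (∀ k → a ≈[ p ℕ.^ k ] b) → a ≈ b
  limit^ e = limit λ k → coarsen (ℕ.<⇒≤ (k<p^k k)) (e k)

  ^ₚ-congˡ : ∀ {u v} y → u ≈ v → u ^ₚ y ≈ v ^ₚ y
  ^ₚ-congˡ y u≈v = limit λ N → trunc-^ₚ y (trunc-≈ u≈v)

  ^ₚ-unit : ∀ {u} y → u ≈[ 1 ] 1# → u ^ₚ y ≈[ 1 ] 1#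
  ^ₚ-unit y u≈1 = trunc-trans (^ₚ-residue y 0 u≈1) (trunc-trans (trunc-^ (residue y 0) u≈1) (trunc-≈ (1^ (residue y 0))))

  ^ₚ-congʳ : ∀ {u y z} → u ≈[ 1 ] 1# → y ≈ₚ z → u ^ₚ y ≈ u ^ₚ z
  ^ₚ-congʳ {y = y} {z} u≈1 y≈z = limit^ λ k → trunc-trans (^ₚ-approx y k (residue z k) u≈1
      (∣ᶻ-sub-trans (+ residue z k) (approx z k) (approx y k) (residue≡approx z k) (∣ᶻ-sub-sym (approx y k) (approx z k) (y≈z k))))
    (trunc-sym (^ₚ-residue z k u≈1))

  ^ₚ-+ : ∀ {u} y z → u ≈[ 1 ] 1# → u ^ₚ (y +ₚ z) ≈ u ^ₚ y * u ^ₚ z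
  ^ₚ-+ {u} y z u≈1 = limit^ λ k → trunc-trans
    (^ₚ-approx (y +ₚ z) k (residue y k ℕ.+ residue z k) u≈1
      (subst (_ ∣ᶻ_) ([i-k]+[j-l]≡[i+j]-[k+l] (+ residue y k) (+ residue z k) (approx y k) (approx z k))
        (∣m∣n⇒∣m+n (residue≡approx y k) (residue≡approx z k))))
    (trunc-trans (trunc-≈ (^-homo-* u (residue y k) (residue z k)))
      (trunc-sym (trunc-* (^ₚ-residue y k u≈1) (^ₚ-residue z k u≈1))))

  ^ₚ-0 : ∀ {u} → u ≈[ 1 ] 1# → u ^ₚ 0ₚ ≈ 1#
  ^ₚ-0 u≈1 = limit^ λ k → ^ₚ-approx 0ₚ k 0 u≈1 (divides (+ 0) ≡.refl)

  ^ₚ-inverse : ∀ {u} y → u ≈[ 1 ] 1# → u ^ₚ y * u ^ₚ (-ₚ y) ≈ 1#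
  ^ₚ-inverse {u} y u≈1 = trans (sym (^ₚ-+ y (-ₚ y) u≈1)) (trans (^ₚ-congʳ u≈1 λ k →
    subst (+ (p ℕ.^ k) ∣ᶻ_) (≡.sym (≡.trans (ℤ.+-identityʳ _) (ℤ.+-inverseʳ (approx y k)))) (divides (+ 0) ≡.refl)) (^ₚ-0 u≈1))

  unit-* : ∀ {u v} → u ≈[ 1 ] 1# → v ≈[ 1 ] 1# → u * v ≈[ 1 ] 1#
  unit-* u≈1 v≈1 = trunc-trans (trunc-* u≈1 v≈1) (trunc-≈ (*-identityʳ 1#))

  *-^ₚ : ∀ {u v} y → u ≈[ 1 ] 1# → v ≈[ 1 ] 1# → (u * v) ^ₚ y ≈ u ^ₚ y * v ^ₚ y
  *-^ₚ {u} {v} y u≈1 v≈1 = limit^ λ k → trunc-trans (^ₚ-residue y k (unit-* u≈1 v≈1))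
    (trunc-trans (trunc-≈ (^-distrib-* u v (residue y k)))
      (trunc-sym (trunc-* (^ₚ-residue y k u≈1) (^ₚ-residue y k v≈1))))

  S-agree : ∀ k {F G} x → F ≈[ k ] G → S k (const ∘ F) x ≈ S k (const ∘ G) x
  S-agree zero    x e = refl
  S-agree (suc k) x e = +-cong (const-cong (below e 0 (s≤s z≤n)))
    (*-congˡ (S-agree k x (trunc λ n n<k → below e (suc n) (s≤s n<k))))

  -- The first k coefficients fix the value modulo π^k, since x^k vanishes there.
  trunc-⟨⟩ : ∀ {k F G x} → x ≈[ 1 ] 0# → F ≈[ k ] G → F ⟨ x ⟩ ≈[ k ] G ⟨ x ⟩
  trunc-⟨⟩ {k} {x = x} x≈0 e = trunc-trans (ev≈S _ x≈0 ℕ.≤-refl) (trunc-trans (trunc-≈ (S-agree k x e)) (trunc-sym (ev≈S _ x≈0 ℕ.≤-refl)))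

  1+x≈1 : ∀ {x} → x ≈[ 1 ] 0# → 1# + x ≈[ 1 ] 1#
  1+x≈1 x≈0 = trunc-trans (trunc-+ trunc-refl x≈0) (trunc-≈ (+-identityʳ 1#))

  -- Here the power as a limit of natural powers meets the binomial series: for natural exponents
  -- substitution into (1 + π)ⁿ is known, and both sides depend continuously on the exponent.
  [1+π]^ₚ-⟨⟩ : ∀ y {x} → x ≈[ 1 ] 0# → ((1# + π) ^ₚ y) ⟨ x ⟩ ≈ (1# + x) ^ₚ y
  [1+π]^ₚ-⟨⟩ y x≈0 = limit^ λ k → trunc-trans (trunc-⟨⟩ x≈0 (^ₚ-residue y k (1+x≈1 π≈0)))
    (trunc-trans (trunc-≈ ([1+π]^-⟨⟩ (residue y k) x≈0)) (trunc-sym (^ₚ-residue y k (1+x≈1 x≈0))))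

  -- (1 + π)ʳ is monic of degree r, so it is 1 modulo a higher power of π only for r = 0.
  [1+π]^ₚ-injective : ∀ y z → (1# + π) ^ₚ y ≈ (1# + π) ^ₚ z → y ≈ₚ z
  [1+π]^ₚ-injective y z e k = subst (+ (p ℕ.^ k) ∣ᶻ_) (ℤ.+-identityʳ _)
    (subst (λ r → + (p ℕ.^ k) ∣ᶻ approx d k ℤ.- + r) (r≡0 (residue d k) (n%ℕd<d (approx d k) (p ℕ.^ k) {{ℕ.m^n≢0 p k}}) [1+π]^r)
      (∣ᶻ-sub-sym (+ residue d k) (approx d k) (residue≡approx d k)))
    where
    d = y +ₚ (-ₚ z)
    u≈1 : 1# + π ≈[ 1 ] 1#
    u≈1 = 1+x≈1 π≈0
    [1+π]^r : (1# + π) ^ residue d k ≈[ p ℕ.^ k ] 1#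
    [1+π]^r = trunc-trans (trunc-sym (^ₚ-residue d k u≈1))
      (trunc-≈ (trans (^ₚ-+ y (-ₚ z) u≈1) (trans (*-congʳ e) (^ₚ-inverse z u≈1))))
    r≡0 : ∀ r → r ℕ.< p ℕ.^ k → (1# + π) ^ r ≈[ p ℕ.^ k ] 1# → r ≡ 0
    r≡0 zero    _   _ = ≡.refl
    r≡0 (suc r) r<q e = contradiction (F.trans (F.sym (below e (suc r) r<q))
      (F.trans ([1+π]^-at (suc r) (suc r)) (F.trans (F.×-congˡ (nCn≡1 (suc r))) (F.+-identityʳ F.1#)))) F.0≉1

  module _ (χ : Character) where

    private F₀ = proj₁ χ

    cofactor : ℤₚ p
    approx   cofactor k = + exponent χ k
    coherent cofactor k = divides (+ proj₁ (step (iterates χ k)))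
      (≡.trans (i+j-i≡j (+ exponent χ k) _) (ℤ.pos-* (proj₁ (step (iterates χ k))) (p ℕ.^ k)))

    character-cofactor : F₀ * (1# + π) ^ₚ cofactor ≈ 1#
    character-cofactor = limit^ λ k → trunc-trans
      (trunc-* trunc-refl (^ₚ-approx cofactor k (exponent χ k) (1+x≈1 π≈0) (divides (+ 0) (ℤ.+-inverseʳ (+ exponent χ k)))))
      (trunc-trans (trunc-≈ (iterates-^ χ k)) (unit-^p^k k (trunc-1 (IsCharacter.normalised (proj₂ (iterates χ k))))))

    character-power : F₀ ≈ (1# + π) ^ₚ (-ₚ cofactor)
    character-power = begin
      F₀                                                          ≈⟨ *-identityʳ F₀ ⟨
      F₀ * 1#                                                     ≈⟨ *-congˡ (^ₚ-inverse cofactor (1+x≈1 π≈0)) ⟨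
      F₀ * ((1# + π) ^ₚ cofactor * (1# + π) ^ₚ (-ₚ cofactor))     ≈⟨ *-assoc _ _ _ ⟨
      F₀ * (1# + π) ^ₚ cofactor * (1# + π) ^ₚ (-ₚ cofactor)       ≈⟨ *-congʳ character-cofactor ⟩
      1# * (1# + π) ^ₚ (-ₚ cofactor)                              ≈⟨ *-identityˡ _ ⟩
      (1# + π) ^ₚ (-ₚ cofactor)                                   ∎
      where open SetoidReasoning setoid

-- Laurent series with cleared denominators, and sums in K.

i-j+j≡i : ∀ i j → i ℤ.- j ℤ.+ j ≡ i
i-j+j≡i = solve 2 (λ i j → i :- j :+ j := i) ≡.refl
  where open ℤSolver.+-*-Solver

i+j-j≡i : ∀ i j → i ℤ.+ j ℤ.- j ≡ i
i+j-j≡i = solve 2 (λ i j → i :+ j :- j := i) ≡.refl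
  where open ℤSolver.+-*-Solver

module Laurent {c ℓ : Level} {p : ℕ} (p-prime : Prime p) (𝔽 : FiniteField c ℓ p) where

  open Truncation p-prime 𝔽
  open Evaluation p-prime 𝔽
  module 𝕂 = OneUnits p-prime 𝔽
  open 𝕂 using (K; pole; coeffs; coeff; extend; fromR; v[_]≥_; HasSum)

  extend-cong : ∀ {a b} → a ≈ b → ∀ i → extend a i F.≈ extend b i
  extend-cong e (+ n)    = at e n
  extend-cong e -[1+ _ ] = F.refl

  extend-shift : ∀ k a i → extend (shift k a) (i ℤ.+ + k) F.≈ extend a i
  extend-shift k a (+ n)    = F.trans (at (shift-π k a) (n ℕ.+ k))
    (F.trans (F.reflexive (cong (π ^ k * a) (ℕ.+-comm n k))) (π^*-at k a n))
  extend-shift k a -[1+ n ] = go k n ℕ.≤-refl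
    where
    go : ∀ j n → j ℕ.≤ k → extend (shift k a) (j ℤ.⊖ suc n) F.≈ F.0#
    go zero    n       _   = F.refl
    go (suc j) zero    j<k = F.trans (F.reflexive (cong (extend (shift k a)) (ℤ.[1+m]⊖[1+n]≡m⊖n j 0)))
      (F.trans (at (shift-π k a) j) (π^*-below k a j j<k))
    go (suc j) (suc n) j<k = F.trans (F.reflexive (cong (extend (shift k a)) (ℤ.[1+m]⊖[1+n]≡m⊖n j (suc n))))
      (go j n (ℕ.<⇒≤ j<k))

  -- πᵐ x = r.
  record Rep (m : ℕ) (x : K) (r : R) : Set ℓ where
    constructor rep
    field scaled : π ^ m * coeffs x ≈ π ^ pole x * r

  open Rep public

  private
    coeff-extend : ∀ x m i → coeff x i F.≈ extend (shift m (coeffs x)) (i ℤ.+ + (pole x ℕ.+ m))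
    coeff-extend x m i = F.sym (F.trans (F.reflexive (cong (extend (shift m (coeffs x))) (≡.sym (ℤ.+-assoc i (+ pole x) (+ m)))))
      (extend-shift m (coeffs x) (i ℤ.+ + pole x)))

    extend-extend : ∀ r m k i → extend r (i ℤ.+ + m) F.≈ extend (shift k r) (i ℤ.+ + (k ℕ.+ m))
    extend-extend r m k i = F.sym (F.trans (F.reflexive (cong (extend (shift k r))
        (≡.trans (cong (λ t → i ℤ.+ + t) (ℕ.+-comm k m)) (≡.sym (ℤ.+-assoc i (+ m) (+ k))))))
      (extend-shift k r (i ℤ.+ + m)))

  rep-coeff : ∀ {m x r} → Rep m x r → ∀ i → coeff x i F.≈ extend r (i ℤ.+ + m)
  rep-coeff {m} {x} {r} (rep e) i = F.trans (coeff-extend x m i)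
    (F.trans (extend-cong (trans (shift-π m (coeffs x)) (trans e (sym (shift-π (pole x) r)))) (i ℤ.+ + (pole x ℕ.+ m)))
      (F.sym (extend-extend r m (pole x) i)))

  coeff-rep : ∀ {m x r} → (∀ i → coeff x i F.≈ extend r (i ℤ.+ + m)) → Rep m x r
  coeff-rep {m} {x} {r} e = rep (trans (sym (shift-π m (coeffs x))) (trans (pointwise go) (shift-π (pole x) r)))
    where
    go : ∀ n → shift m (coeffs x) n F.≈ shift (pole x) r n
    go n = ≡.subst (λ t → extend (shift m (coeffs x)) t F.≈ extend (shift (pole x) r) t) (i-j+j≡i (+ n) (+ (pole x ℕ.+ m)))
      (F.trans (F.sym (coeff-extend x m i)) (F.trans (e i) (extend-extend r m (pole x) i)))
      where i = + n ℤ.- + (pole x ℕ.+ m)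

  rep-self : ∀ x → Rep (pole x) x (coeffs x)
  rep-self x = rep refl

  rep-fromR : ∀ r → Rep 0 (fromR r) r
  rep-fromR r = rep refl

  rep-cong : ∀ {m x r s} → r ≈ s → Rep m x r → Rep m x s
  rep-cong r≈s (rep e) = rep (trans e (*-congˡ r≈s))

  rep-index : ∀ {m n x r} → m ≡ n → Rep m x r → Rep n x r
  rep-index ≡.refl e = e

  rep-raise : ∀ {m x r} k → Rep m x r → Rep (k ℕ.+ m) x (π ^ k * r)
  rep-raise {m} {x} {r} k (rep e) = rep (trans (*-congʳ (^-homo-* π k m)) (trans (*-assoc _ _ _) (trans (*-congˡ e)
    (solve 3 (λ k P r → k :* (P :* r) := P :* (k :* r)) refl (π ^ k) (π ^ pole x) r))))

  rep-lower : ∀ {m x r} k → Rep (k ℕ.+ m) x (π ^ k * r) → Rep m x r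
  rep-lower {m} {x} {r} k (rep e) = rep (π^-cancel k (trans (sym (*-assoc _ _ _)) (trans (*-congʳ (sym (^-homo-* π k m)))
    (trans e (solve 3 (λ k P r → P :* (k :* r) := k :* (P :* r)) refl (π ^ k) (π ^ pole x) r)))))

  rep-≈⇒ : ∀ {m x y r s} → Rep m x r → Rep m y s → x 𝕂.≈ y → r ≈ s
  rep-≈⇒ {m} {x} {y} {r} {s} d e x≈y = pointwise λ n →
    ≡.subst (λ t → extend r t F.≈ extend s t) (i-j+j≡i (+ n) (+ m))
      (F.trans (F.sym (rep-coeff d (+ n ℤ.- + m))) (F.trans (x≈y (+ n ℤ.- + m)) (rep-coeff e (+ n ℤ.- + m))))

  rep-≈⇐ : ∀ {m x y r s} → Rep m x r → Rep m y s → r ≈ s → x 𝕂.≈ y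
  rep-≈⇐ {m} d e r≈s i = F.trans (rep-coeff d i) (F.trans (extend-cong r≈s (i ℤ.+ + m)) (F.sym (rep-coeff e i)))

  rep-+ : ∀ {m x y r s} → Rep m x r → Rep m y s → Rep m (x 𝕂.+ y) (r + s)
  rep-+ {m} {x} {y} {r} {s} (rep d) (rep e) = rep (begin
    π ^ m * coeffs (x 𝕂.+ y)
      ≈⟨ *-congˡ (trans (pointwise λ n → F.reflexive (≡.sym (⊕-at _ _ n))) (+-cong (shift-π Q a) (shift-π P b))) ⟩
    π ^ m * (π ^ Q * a + π ^ P * b)
      ≈⟨ solve 5 (λ m Q a P b → m :* (Q :* a :+ P :* b) := Q :* (m :* a) :+ P :* (m :* b)) refl (π ^ m) (π ^ Q) a (π ^ P) b ⟩
    π ^ Q * (π ^ m * a) + π ^ P * (π ^ m * b)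
      ≈⟨ +-cong (*-congˡ d) (*-congˡ e) ⟩
    π ^ Q * (π ^ P * r) + π ^ P * (π ^ Q * s)
      ≈⟨ solve 4 (λ Q P r s → Q :* (P :* r) :+ P :* (Q :* s) := (P :* Q) :* (r :+ s)) refl (π ^ Q) (π ^ P) r s ⟩
    π ^ P * π ^ Q * (r + s)
      ≈⟨ *-congʳ (^-homo-* π P Q) ⟨
    π ^ (P ℕ.+ Q) * (r + s) ∎)
    where
    open SetoidReasoning setoid
    P = pole x
    Q = pole y
    a = coeffs x
    b = coeffs y

  rep-neg : ∀ {m x r} → Rep m x r → Rep m (𝕂.- x) (- r)
  rep-neg {m} {x} {r} (rep e) = rep (trans (*-congˡ (pointwise λ n → F.reflexive (≡.sym (⊖-at (coeffs x) n))))
    (trans (sym (-‿distribʳ-* (π ^ m) (coeffs x))) (trans (-‿cong e) (-‿distribʳ-* (π ^ pole x) r))))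
    where open RingProperties ring

  rep-sub : ∀ {m x y r s} → Rep m x r → Rep m y s → Rep m (x 𝕂.- y) (r - s)
  rep-sub d e = rep-+ d (rep-neg e)

  rep-* : ∀ {m n x y r s} → Rep m x r → Rep n y s → Rep (m ℕ.+ n) (x 𝕂.* y) (r * s)
  rep-* {m} {n} {x} {y} {r} {s} (rep d) (rep e) = rep (begin
    π ^ (m ℕ.+ n) * coeffs (x 𝕂.* y)
      ≈⟨ *-cong (^-homo-* π m n) (reflexive (≡.sym (⊗-def (coeffs x) (coeffs y)))) ⟩
    π ^ m * π ^ n * (coeffs x * coeffs y)
      ≈⟨ solve 4 (λ m n a b → m :* n :* (a :* b) := (m :* a) :* (n :* b)) refl (π ^ m) (π ^ n) (coeffs x) (coeffs y) ⟩
    (π ^ m * coeffs x) * (π ^ n * coeffs y)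
      ≈⟨ *-cong d e ⟩
    (π ^ pole x * r) * (π ^ pole y * s)
      ≈⟨ solve 4 (λ m n a b → (m :* a) :* (n :* b) := m :* n :* (a :* b)) refl (π ^ pole x) (π ^ pole y) r s ⟩
    π ^ pole x * π ^ pole y * (r * s)
      ≈⟨ *-congʳ (^-homo-* π (pole x) (pole y)) ⟨
    π ^ (pole x ℕ.+ pole y) * (r * s) ∎)
    where open SetoidReasoning setoid

  rep-^ : ∀ {x r} n → Rep 0 x r → Rep 0 (x 𝕂.^ n) (r ^ n)
  rep-^ zero    e = rep refl
  rep-^ (suc n) e = rep-* e (rep-^ n e)

  rep-0 : ∀ m → Rep m 𝕂.0# 0#
  rep-0 m = rep (trans (*-congˡ const-0) (trans (zeroʳ _) (sym (zeroʳ _))))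

  -- The factor y absorbs the powers of x that the Horner form peels off during the induction; in
  -- the application it starts as 1.
  rep-sum : ∀ {m x y b} n {f : ℕ → K} → (∀ i → Rep m (f i) (y * (x ^ i * b i))) →
            Rep m (𝕂.sum {n} (λ i → f (toℕ i))) (y * S n b x)
  rep-sum {m} {y = y} zero e = rep-cong (sym (zeroʳ y)) (rep-0 m)
  rep-sum {x = x} {y} {b} (suc n) e = rep-cong
    (solve 4 (λ y b x s → y :* (con 1 :* b) :+ y :* x :* s := y :* (b :+ x :* s)) refl y (b 0) x (S n (b ∘ suc) x))
    (rep-+ (e 0) (rep-sum n λ i → rep-cong
      (solve 4 (λ y x t b → y :* (x :* t :* b) := y :* x :* (t :* b)) refl y x (x ^ i) (b (suc i))) (e (suc i))))

  rep-v⇒ : ∀ {m x r} k → Rep m x r → v[ x ]≥ + k → r ≈[ k ℕ.+ m ] 0#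
  rep-v⇒ {m} {x} {r} k e v = trunc λ n n<k+m → F.trans
    (≡.subst (λ t → extend r t F.≈ F.0#) (i-j+j≡i (+ n) (+ m))
      (F.trans (F.sym (rep-coeff e (+ n ℤ.- + m))) (v (+ n ℤ.- + m)
        (≡.subst₂ ℤ._<_ ≡.refl (i+j-j≡i (+ k) (+ m))
          (ℤ.+-monoˡ-< (ℤ.- + m) (ℤ.+<+ n<k+m))))))
    (F.reflexive (≡.sym (𝟘-at n)))

  rep-v⇐ : ∀ {m x r} k → Rep m x r → r ≈[ k ℕ.+ m ] 0# → v[ x ]≥ + k
  rep-v⇐ {m} {x} {r} k e r≈0 i i<k = F.trans (rep-coeff e i) (go (i ℤ.+ + m) (ℤ.+-monoˡ-< (+ m) i<k))
    where
    go : ∀ j → j ℤ.< + (k ℕ.+ m) → extend r j F.≈ F.0#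
    go (+ n)    (ℤ.+<+ n<k+m) = F.trans (below r≈0 n n<k+m) (F.reflexive (𝟘-at n))
    go -[1+ _ ] _             = F.refl

  rep-bounded : ∀ m x → v[ x ]≥ (ℤ.- + m) → Rep m x (λ n → coeff x (+ n ℤ.- + m))
  rep-bounded m x v = coeff-rep λ i → go i (i ℤ.+ + m) ≡.refl
    where
    go : ∀ i j → j ≡ i ℤ.+ + m → coeff x i F.≈ extend (λ n → coeff x (+ n ℤ.- + m)) j
    go i (+ n)    e = F.reflexive (cong (coeff x) (≡.sym (≡.trans (cong (ℤ._- + m) e) (i+j-j≡i i (+ m)))))
    go i -[1+ n ] e = v i (≡.subst₂ ℤ._<_ (≡.trans (cong (ℤ._- + m) e) (i+j-j≡i i (+ m))) (ℤ.+-identityˡ (ℤ.- + m)) (ℤ.+-monoˡ-< (ℤ.- + m) ℤ.-<+))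

  sub≈0⇒ : ∀ {N a b} → a - b ≈[ N ] 0# → a ≈[ N ] b
  sub≈0⇒ {a = a} {b} e = trunc-trans (trunc-≈ (sym (trans (+-assoc a (- b) b) (trans (+-congˡ (-‿inverseˡ b)) (+-identityʳ a)))))
    (trunc-trans (trunc-+ e trunc-refl) (trunc-≈ (+-identityˡ b)))

  ⇒sub≈0 : ∀ {N a b} → a ≈[ N ] b → a - b ≈[ N ] 0#
  ⇒sub≈0 {b = b} e = trunc-trans (trunc-+ e trunc-refl) (trunc-≈ (-‿inverseʳ b))

  module _ {m : ℕ} {x : R} {b : ℕ → R} {f : ℕ → K} {s : K} {r : R}
           (x≈0 : x ≈[ 1 ] 0#) (terms : ∀ n → Rep m (f n) (x ^ n * b n)) (total : Rep m s r) where

    private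
      partial : ∀ n → Rep m (𝕂.sum {n} (λ i → f (toℕ i)) 𝕂.- s) (S n b x - r)
      partial n = rep-sub (rep-cong (*-identityˡ _) (rep-sum n λ i → rep-cong (sym (*-identityˡ _)) (terms i))) total

    -- The terms in K are π^(-m) xⁿ bₙ, so up to π^m the sum is a formal evaluation. A partial sum
    -- of length at least N and at least k is close to both limits modulo π^k.
    hasSum⇒ev : HasSum f s → ev b x ≈ r
    hasSum⇒ev h = limit λ k → let N , v = h k in trunc-trans (ev≈S b x≈0 (ℕ.m≤n⊔m N k))
      (coarsen (ℕ.m≤m+n k m) (sub≈0⇒ (rep-v⇒ k (partial (N ℕ.⊔ k)) (v (N ℕ.⊔ k) (ℕ.m≤m⊔n N k)))))

    ev⇒hasSum : ev b x ≈ r → HasSum f s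
    -- Precision k in K is precision k + m after multiplication by π^m, and n terms of the formal
    -- series give precision n.
    ev⇒hasSum e k = k ℕ.+ m , λ n N≤n → rep-v⇐ k (partial n)
      (⇒sub≈0 (trunc-trans (trunc-sym (ev≈S b x≈0 N≤n)) (trunc-≈ e)))

-- Power maps belong to Λ.

module PowerMaps {c ℓ : Level} {p : ℕ} (p-prime : Prime p) (𝔽 : FiniteField c ℓ p) where

  open Truncation p-prime 𝔽
  open Evaluation p-prime 𝔽
  open Powers p-prime 𝔽
  open Laurent p-prime 𝔽
  open 𝕂 using (laurent; fromR; U; oneUnit; series; constant; fromU; _≈ᵁ_; _·_; Λ; IsPower; Continuous; AnalyticNear; _∈B[_,_]; HasSum; reduce; binom)

  series≈1 : ∀ u → series u ≈[ 1 ] 1#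
  series≈1 u = trunc-1 (constant u)

  ≈ᵁ⇒≈ : ∀ {u v} → u ≈ᵁ v → series u ≈ series v
  ≈ᵁ⇒≈ = rep-≈⇒ (rep-fromR _) (rep-fromR _)

  ≈⇒≈ᵁ : ∀ {u v} → series u ≈ series v → u ≈ᵁ v
  ≈⇒≈ᵁ = rep-≈⇐ (rep-fromR _) (rep-fromR _)

  ·-series : ∀ u v → series (u · v) ≈ series u * series v
  ·-series u v = reflexive (≡.sym (⊗-def (series u) (series v)))

  infixr 8 _^ᵁ_
  _^ᵁ_ : U → ℤₚ p → U
  u ^ᵁ y = oneUnit (series u ^ₚ y) (below (^ₚ-unit y (series≈1 u)) 0 (s≤s z≤n))

  isPower : ∀ y u → IsPower u y (u ^ᵁ y)
  isPower y u = ev⇒hasSum {b = λ n → const (reduce (binom y n))} x≈0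
    (λ n → rep-cong (*-comm _ _) (rep-* (rep-fromR _) (rep-^ n (rep-sub (rep-fromR _) (rep-fromR _)))))
    (rep-fromR _)
    (trans (ev-cong (λ n → const-cong (reduce-binom y n)) refl)
      (trans ([1+π]^ₚ-⟨⟩ y x≈0) (^ₚ-congˡ y (1+[u-1]≈u (series u)))))
    where
    x≈0 : series u - 1# ≈[ 1 ] 0#
    x≈0 = unit-decompose (series≈1 u)

  -- The modulus of continuity is k itself: raising to the power y preserves congruence modulo π^k.
  ^ᵁ-continuous : ∀ y → Continuous (λ u → fromU (u ^ᵁ y))
  ^ᵁ-continuous y u k = k , λ v close →
    rep-v⇐ k (rep-sub (rep-fromR _) (rep-fromR _)) (⇒sub≈0 (trunc-^ₚ y
      (sub≈0⇒ (rep-v⇒ k (rep-sub (rep-fromR (series v)) (rep-fromR (series u))) close))))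

  -- uʸ = αʸ (1 + α⁻¹ (u - α))ʸ.
  ^ᵁ-analytic : ∀ y α → AnalyticNear (λ u → fromU (u ^ᵁ y)) α
  ^ᵁ-analytic y α = record
    -- The ball of radius |π| about α is all of U, so one expansion serves globally.
    { ρ         = π
    ; ρ⁻¹       = laurent 1 1#
    ; ρ-inverse = rep-≈⇐ (rep-* (rep-fromR π) (rep-self (laurent 1 1#))) (rep-raise 1 (rep-fromR 1#)) (*-congʳ (sym (*-identityʳ π)))
    ; B⊆U       = λ u u∈B → F.trans (below (near u u∈B) 0 (s≤s z≤n)) (constant α)
    -- α⁻¹ (u - α) = (α⁻¹ π) · (u - α)/π. The powers of α⁻¹ π go into the coefficients and force
    -- them to 0.
    ; coef      = λ n → fromR ((α⁻¹ * π) ^ n * (a ^ₚ y * const (B n)))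
    ; coef⟶0    = λ k → k , λ n k≤n → rep-v⇐ k (rep-sub (rep-fromR _) (rep-0 0))
                    (⇒sub≈0 (coarsen (ℕ.≤-trans (ℕ.≤-reflexive (ℕ.+-identityʳ k)) k≤n)
                      (trunc-trans (trunc-* (trunc-^-0 n (trunc-*ʳ-0 α⁻¹ π≈0)) trunc-refl) (trunc-≈ (zeroˡ _)))))
    ; expansion = expansion
    }
    where
    a = series α
    a≈1 = series≈1 α
    B = (1# + π) ^ₚ y
    one : ℤₚ p
    one = record { approx = λ _ → + 1 ; coherent = λ _ → divides (+ 0) ≡.refl }
    -- The inverse of a 1-unit is its power with exponent -1 in ℤₚ.
    α⁻¹ = a ^ₚ (-ₚ one)
    αα⁻¹≈1 : a * α⁻¹ ≈ 1#
    αα⁻¹≈1 = trans (*-congʳ (sym (trans (limit^ λ k → ^ₚ-approx one k 1 a≈1 (divides (+ 0) ≡.refl)) (*-identityʳ a)))) (^ₚ-inverse one a≈1)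
    near : ∀ u → u ∈B[ a , π ] → u ≈[ 1 ] a
    near u u∈B = sub≈0⇒ (rep-v⇒ 1 (rep-sub (rep-fromR u) (rep-fromR a)) (u∈B (+ 1) (rep-v⇐ 1 (rep-fromR π) π≈0)))
    expansion : ∀ u → series u ∈B[ a , π ] →
      HasSum (λ n → fromR ((α⁻¹ * π) ^ n * (a ^ₚ y * const (B n))) 𝕂.* ((fromU u 𝕂.- fromU α) 𝕂.* laurent 1 1#) 𝕂.^ n) (fromU (u ^ᵁ y))
    expansion u u∈B = ev⇒hasSum {b = λ n → a ^ₚ y * const (B n)} z≈0
      (λ n → rep-cong (rearrange n) (rep-* (rep-fromR _) (rep-^ n quotient)))
      (rep-fromR _)
      (begin
        ev (λ n → a ^ₚ y * const (B n)) z   ≈⟨ ev-*ˡ (a ^ₚ y) (const ∘ B) z≈0 ⟩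
        a ^ₚ y * B ⟨ z ⟩                    ≈⟨ *-congˡ ([1+π]^ₚ-⟨⟩ y z≈0) ⟩
        a ^ₚ y * (1# + z) ^ₚ y              ≈⟨ *-^ₚ y a≈1 (1+x≈1 z≈0) ⟨
        (a * (1# + z)) ^ₚ y                 ≈⟨ ^ₚ-congˡ y a[1+z]≈u ⟩
        series u ^ₚ y                       ∎)
      where
      open SetoidReasoning setoid
      d = series u - a
      d≈0 : d ≈[ 1 ] 0#
      d≈0 = ⇒sub≈0 (near (series u) u∈B)
      t = drop 1 d
      d≈πt : d ≈ π * t
      d≈πt = trans (factor {1} d≈0) (*-congʳ (*-identityʳ π))
      z = α⁻¹ * π * t
      z≈0 : z ≈[ 1 ] 0#
      z≈0 = trunc-trans (trunc-* (trunc-*ʳ-0 α⁻¹ π≈0) trunc-refl) (trunc-≈ (zeroˡ t))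
      quotient : Rep 0 ((fromU u 𝕂.- fromU α) 𝕂.* laurent 1 1#) t
      quotient = rep-lower 1 (rep-cong (trans (*-identityʳ d) (trans d≈πt (*-congʳ (sym (*-identityʳ π)))))
        (rep-* (rep-sub (rep-fromR (series u)) (rep-fromR a)) (rep-self (laurent 1 1#))))
      rearrange : ∀ n → (α⁻¹ * π) ^ n * (a ^ₚ y * const (B n)) * t ^ n ≈ z ^ n * (a ^ₚ y * const (B n))
      rearrange n = trans (solve 3 (λ r b s → r :* b :* s := r :* s :* b) refl _ _ _) (*-congʳ (sym (^-distrib-* (α⁻¹ * π) t n)))
      a[1+z]≈u : a * (1# + z) ≈ series u
      a[1+z]≈u = begin
        a * (1# + α⁻¹ * π * t)      ≈⟨ solve 4 (λ a b π t → a :* (con 1 :+ b :* π :* t) := a :+ (a :* b) :* (π :* t)) refl a α⁻¹ π t ⟩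
        a + (a * α⁻¹) * (π * t)     ≈⟨ +-congˡ (*-cong αα⁻¹≈1 (sym d≈πt)) ⟩
        a + 1# * d                  ≈⟨ +-congˡ (*-identityˡ d) ⟩
        a + (series u - a)          ≈⟨ +-comm a d ⟩
        series u - a + a            ≈⟨ +-assoc _ _ _ ⟩
        series u + (- a + a)        ≈⟨ trans (+-congˡ (-‿inverseˡ a)) (+-identityʳ _) ⟩
        series u                    ∎

  pow : ℤₚ p → Λ
  pow y = record
    { map             = record { to = _^ᵁ y ; cong = λ {u} {v} u≈v → ≈⇒≈ᵁ {u ^ᵁ y} {v ^ᵁ y} (^ₚ-congˡ y (≈ᵁ⇒≈ {u} {v} u≈v)) }
    ; locallyAnalytic = ^ᵁ-continuous y , ^ᵁ-analytic y
    ; multiplicative  = λ u v → ≈⇒≈ᵁ {(u · v) ^ᵁ y} {u ^ᵁ y · v ^ᵁ y} (trans (^ₚ-congˡ y (·-series u v))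
        (trans (*-^ₚ y (series≈1 u) (series≈1 v)) (sym (·-series (u ^ᵁ y) (v ^ᵁ y)))))
    }

-- Locally analytic homomorphisms are power maps.

m[1+n]≡nm+m : ∀ m n → m ℕ.* suc n ≡ n ℕ.* m ℕ.+ m
m[1+n]≡nm+m = solve 2 (λ m n → m :* (con 1 :+ n) := n :* m :+ m) ≡.refl
  where open ℕSolver.+-*-Solver

mp+Ppn≡p[m+Pn] : ∀ m p P n → m ℕ.* p ℕ.+ P ℕ.* p ℕ.* n ≡ p ℕ.* (m ℕ.+ P ℕ.* n)
mp+Ppn≡p[m+Pn] = solve 4 (λ m p P n → m :* p :+ P :* p :* n := p :* (m :+ P :* n)) ≡.refl
  where open ℕSolver.+-*-Solver

module LocallyAnalyticMaps {c ℓ : Level} {p : ℕ} (p-prime : Prime p) (𝔽 : FiniteField c ℓ p) where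

  open Truncation p-prime 𝔽
  open Evaluation p-prime 𝔽
  open FormalCharacters p-prime 𝔽
  open Powers p-prime 𝔽
  open Laurent p-prime 𝔽
  open PowerMaps p-prime 𝔽
  open 𝕂 using (K; coeff; pole; coeffs; fromR; U; oneUnit; series; fromU; _≈ᵁ_; _·_; Λ; AnalyticNear; v[_]≥_; _⟶_; _∈B[_,_])

  p′ : ℕ
  p′ = ℕ.pred p

  p≡1+p′ : p ≡ suc p′
  p≡1+p′ = ≡.sym (ℕ.suc-pred p)

  0<p′ : 0 ℕ.< p′
  0<p′ = ℕ.≤-pred (subst (1 ℕ.<_) p≡1+p′ (ℕ.nonTrivial⇒n>1 p {{prime⇒nonTrivial p-prime}}))

  kp≡p′k+k : ∀ k → k ℕ.* p ≡ p′ ℕ.* k ℕ.+ k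
  kp≡p′k+k k = ≡.trans (cong (k ℕ.*_) p≡1+p′) (m[1+n]≡nm+m k p′)

  0^p : F.0# F.^ p F.≈ F.0#
  0^p = subst (λ n → F.0# F.^ n F.≈ F.0#) (ℕ.suc-pred p) (F.zeroˡ _)

  module _ (M : ℕ) {r : R} (e : r ^ p ≈ π ^ (p′ ℕ.* M) * r) where

    private
      A = p′ ℕ.* M

      at-multiple : ∀ k → (r ^ p) (k ℕ.* p) F.≈ r k F.^ p
      at-multiple k = subst (λ t → (r ^ p) t F.≈ r k F.^ p) (ℕ.+-identityʳ (k ℕ.* p)) (frobenius-at k 0 (ℕ.>-nonZero⁻¹ p) r)

      above : ∀ n → (r ^ p) (A ℕ.+ n) F.≈ r n
      above n = F.trans (at e (A ℕ.+ n)) (π^*-at A r n)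

      -- The coefficient of π^(kp) is r_kᵖ on the left and r at index kp - A on the right. For k < M
      -- that index is negative or smaller than k, so r_kᵖ = 0 by induction.
      coefficient-< : ∀ k → k ℕ.< M → r k F.≈ F.0#
      coefficient-< = <-rec (λ k → k ℕ.< M → r k F.≈ F.0#) go
        where
        go : ∀ k → (∀ {m} → m ℕ.< k → m ℕ.< M → r m F.≈ F.0#) → k ℕ.< M → r k F.≈ F.0#
        go k ih k<M with split A (k ℕ.* p)
        ... | inj₁ kp<A       = x^n≈0⇒x≈0 p (F.trans (F.sym (at-multiple k)) (F.trans (at e (k ℕ.* p)) (π^*-below A r (k ℕ.* p) kp<A)))
        ... | inj₂ (m , kp≡A+m) = x^n≈0⇒x≈0 p (F.trans (F.sym (at-multiple k))
              (F.trans (F.reflexive (cong (r ^ p) kp≡A+m)) (F.trans (above m) (ih m<k (ℕ.<-trans m<k k<M)))))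
          where
          m<k : m ℕ.< k
          m<k = ℕ.+-cancelˡ-< A m k (subst (ℕ._< A ℕ.+ k) (≡.trans (≡.sym (kp≡p′k+k k)) kp≡A+m)
            (ℕ.+-monoˡ-< k (ℕ.*-monoʳ-< p′ {{ℕ.>-nonZero 0<p′}} k<M)))

      -- The coefficient of π^(A+k) is r_k on the right. On the left it vanishes unless A + k = np,
      -- and then it is rₙᵖ with M < n < k.
      coefficient-> : ∀ k → M ℕ.< k → r k F.≈ F.0#
      coefficient-> = <-rec (λ k → M ℕ.< k → r k F.≈ F.0#) go
        where
        go : ∀ k → (∀ {m} → m ℕ.< k → M ℕ.< m → r m F.≈ F.0#) → M ℕ.< k → r k F.≈ F.0#
        go k ih M<k = F.trans (F.sym (above k)) (F.trans (F.reflexive (cong (r ^ p) (≡.trans A+k≡ (ℕ.+-comm j (n ℕ.* p)))))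
            (F.trans (frobenius-at n j (m%n<n (A ℕ.+ k) p) r) (vanish j A+k≡)))
          where
          n = (A ℕ.+ k) ℕ./ p
          j = (A ℕ.+ k) ℕ.% p
          A+k≡ : A ℕ.+ k ≡ j ℕ.+ n ℕ.* p
          A+k≡ = m≡m%n+[m/n]*n (A ℕ.+ k) p
          vanish : ∀ j → A ℕ.+ k ≡ j ℕ.+ n ℕ.* p → const (r n F.^ p) j F.≈ F.0#
          vanish (suc j) _     = F.refl
          vanish zero    A+k≡np = F.trans (F.^-congˡ p (ih n<k M<n)) 0^p
            where
            M<n : M ℕ.< n
            M<n = ℕ.*-cancelʳ-< p M n (≡.subst₂ ℕ._<_ (≡.sym (kp≡p′k+k M)) A+k≡np (ℕ.+-monoʳ-< A M<k))
            n<k : n ℕ.< k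
            n<k = ℕ.*-cancelʳ-< p n k (≡.subst₂ ℕ._<_ A+k≡np (≡.sym (kp≡p′k+k k))
              (ℕ.+-monoˡ-< k (ℕ.*-monoʳ-< p′ {{ℕ.>-nonZero 0<p′}} M<k)))

    coefficient-fixed : r M F.^ p F.≈ r M
    coefficient-fixed = F.trans (F.sym (at-multiple M)) (F.trans (F.reflexive (cong (r ^ p) (kp≡p′k+k M))) (above M))

    -- In K, r / π^M is a solution of yᵖ = y, and such a y is a constant.
    monomial : r ≈ π ^ M * const (r M)
    monomial = π^*-unique M coefficient-< λ where
      zero    → F.reflexive (cong r (ℕ.+-identityʳ M))
      (suc n) → coefficient-> (M ℕ.+ suc n) (ℕ.m<m+n M (s≤s z≤n))

  -- From some index on the terms are integral; before it, finitely many poles have a maximum. The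
  -- bound is a common denominator for the sequence.
  bounded : ∀ {a : ℕ → K} → a ⟶ 𝕂.0# → ∃[ m ] ∀ n → v[ a n ]≥ (ℤ.- + m)
  bounded {a} a⟶0 = let N , small = a⟶0 0 in bound N , λ n → go N small n
    where
    bound : ℕ → ℕ
    bound zero    = 0
    bound (suc N) = pole (a N) ℕ.⊔ bound N
    weaken : ∀ {x k m} → k ℕ.≤ m → v[ x ]≥ (ℤ.- + k) → v[ x ]≥ (ℤ.- + m)
    weaken k≤m v i i<m = v i (ℤ.<-≤-trans i<m (ℤ.neg-mono-≤ (ℤ.+≤+ k≤m)))
    v≥pole : ∀ x → v[ x ]≥ (ℤ.- + pole x)
    v≥pole x i i<m = negative (i ℤ.+ + pole x) (subst (i ℤ.+ + pole x ℤ.<_) (ℤ.+-inverseˡ (+ pole x)) (ℤ.+-monoˡ-< (+ pole x) i<m))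
      where
      negative : ∀ j → j ℤ.< + 0 → 𝕂.extend (coeffs x) j F.≈ F.0#
      negative -[1+ _ ] _ = F.refl
      negative (+ _) (ℤ.+<+ ())
    go : ∀ N → (∀ n → N ℕ.≤ n → v[ a n 𝕂.- 𝕂.0# ]≥ + 0) → ∀ n → v[ a n ]≥ (ℤ.- + bound N)
    go N small n with ℕ.<-≤-connex n N
    ... | inj₁ n<N = early N n<N
      where
      early : ∀ N → n ℕ.< N → v[ a n ]≥ (ℤ.- + bound N)
      early (suc N) (s≤s n≤N) with ℕ.m≤n⇒m<n∨m≡n n≤N
      ... | inj₁ n<N    = weaken {a n} (ℕ.m≤n⊔m (pole (a N)) (bound N)) (early N n<N)
      ... | inj₂ ≡.refl = weaken {a n} (ℕ.m≤m⊔n (pole (a n)) (bound n)) (v≥pole (a n))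
    ... | inj₂ N≤n = weaken {a n} {0} z≤n
      (rep-v⇐ 0 (rep-self (a n)) (trunc-trans (trunc-≈ (sym (trans (+-congˡ (RingProperties.-0#≈0# ring)) (+-identityʳ _))))
        (rep-v⇒ 0 (rep-sub (rep-self (a n)) (rep-0 _)) (small n N≤n))))

  module _ (f : Λ) where

    open Λ f using (to; locallyAnalytic) renaming (cong to to-cong; multiplicative to to-·)

    unit : ∀ {x} → x ≈[ 1 ] 0# → U
    unit {x} x≈0 = oneUnit (1# + x) (below (1+x≈1 x≈0) 0 (s≤s z≤n))

    opaque

      -- f(1 + x).
      g : ∀ {x} → x ≈[ 1 ] 0# → R
      g x≈0 = series (to (unit x≈0))

      g-to : ∀ {x} (x≈0 : x ≈[ 1 ] 0#) u → 1# + x ≈ series u → g x≈0 ≈ series (to u)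
      g-to x≈0 u e = ≈ᵁ⇒≈ {to (unit x≈0)} {to u} (to-cong (≈⇒≈ᵁ {unit x≈0} {u} e))

      g-rep : ∀ {x} (x≈0 : x ≈[ 1 ] 0#) → Rep 0 (fromU (to (unit x≈0))) (g x≈0)
      g-rep x≈0 = rep-fromR _

      g-cong : ∀ {x y} (x≈0 : x ≈[ 1 ] 0#) (y≈0 : y ≈[ 1 ] 0#) → x ≈ y → g x≈0 ≈ g y≈0
      g-cong x≈0 y≈0 x≈y = g-to x≈0 (unit y≈0) (+-congˡ x≈y)

      g-≈1 : ∀ {x} (x≈0 : x ≈[ 1 ] 0#) → g x≈0 ≈[ 1 ] 1#
      g-≈1 x≈0 = series≈1 (to (unit x≈0))

      g-* : ∀ {x y} (x≈0 : x ≈[ 1 ] 0#) (y≈0 : y ≈[ 1 ] 0#) → g x≈0 * g y≈0 ≈ g (x+y+xy≈0 x≈0 y≈0)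
      g-* {x} {y} x≈0 y≈0 = sym (trans (g-to (x+y+xy≈0 x≈0 y≈0) (unit x≈0 · unit y≈0)
          (trans (solve 2 (λ x y → con 1 :+ (x :+ y :+ x :* y) := (con 1 :+ x) :* (con 1 :+ y)) refl x y) (sym (·-series (unit x≈0) (unit y≈0)))))
        (trans (≈ᵁ⇒≈ {to (unit x≈0 · unit y≈0)} {to (unit x≈0) · to (unit y≈0)} (to-· (unit x≈0) (unit y≈0))) (·-series (to (unit x≈0)) (to (unit y≈0)))))

    -- An idempotent 1-unit equals all its p^k-th powers, hence 1.
    g-0 : g {0#} trunc-refl ≈ 1#
    g-0 = limit^ λ k → trunc-trans (trunc-≈ (sym (power (p ℕ.^ k) {{ℕ.m^n≢0 p k}}))) (unit-^p^k k (g-≈1 trunc-refl))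
      where
      v = g {0#} trunc-refl
      idempotent : v * v ≈ v
      idempotent = trans (g-* trunc-refl trunc-refl) (g-cong _ _ (trans (+-congˡ (zeroˡ 0#)) (trans (+-identityʳ _) (+-identityʳ 0#))))
      power : ∀ n .{{_ : NonZero n}} → v ^ n ≈ v
      power (suc zero)    = *-identityʳ v
      power (suc (suc n)) = trans (*-congˡ (power (suc n))) idempotent

    g-^ : ∀ n {x} (x≈0 : x ≈[ 1 ] 0#) → ∃[ z ] Σ[ z≈0 ∈ z ≈[ 1 ] 0# ] 1# + z ≈ (1# + x) ^ n × g x≈0 ^ n ≈ g z≈0
    g-^ zero    x≈0 = 0# , trunc-refl , +-identityʳ 1# , sym g-0
    g-^ (suc n) {x} x≈0 = let z , z≈0 , 1+z , gz = g-^ n x≈0 in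
      x + z + x * z , x+y+xy≈0 x≈0 z≈0 ,
      trans (solve 2 (λ x z → con 1 :+ (x :+ z :+ x :* z) := (con 1 :+ x) :* (con 1 :+ z)) refl x z) (*-congˡ 1+z) ,
      trans (*-congˡ gz) (g-* x≈0 z≈0)

    -- f commutes with powers, and (1 + x)^(p^k) = 1 + x^(p^k).
    g-frobenius^ : ∀ k {x} (x≈0 : x ≈[ 1 ] 0#) (x^≈0 : x ^ (p ℕ.^ k) ≈[ 1 ] 0#) → g x≈0 ^ (p ℕ.^ k) ≈ g x^≈0
    g-frobenius^ k {x} x≈0 x^≈0 = let z , z≈0 , 1+z , gz = g-^ (p ℕ.^ k) x≈0 in
      trans gz (g-cong z≈0 x^≈0 (RingProperties.+-cancelˡ ring 1# _ _
        (trans 1+z (trans (freshman^ charℛ p-prime k 1# x) (+-congʳ (1^ (p ℕ.^ k)))))))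

    private
      analytic = proj₂ locallyAnalytic (oneUnit 1# F.refl)
      open AnalyticNear analytic using (ρ; ρ⁻¹; ρ-inverse; coef; coef⟶0; expansion)

      -- ρ⁻¹ = π^(-P) e, so at u = 1 + π^P x the variable (u - 1)/ρ of the expansion is the integral
      -- element e x.
      P = pole ρ⁻¹
      e = coeffs ρ⁻¹
      m = proj₁ (bounded coef⟶0)

      numerator : ℕ → R
      numerator n i = coeff (coef n) (+ i ℤ.- + m)

      numerator-rep : ∀ n → Rep m (coef n) (numerator n)
      numerator-rep n = rep-bounded m (coef n) (proj₂ (bounded coef⟶0) n)

      -- The coefficient of xⁿ in π^m f(1 + π^P x): the factor eⁿ comes from the change of variable,
      -- the numerator from clearing the denominator of `coef n`.
      b : ℕ → R
      b n = e ^ n * numerator n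

      π^P*≈0 : ∀ {x} → x ≈[ 1 ] 0# → π ^ P * x ≈[ 1 ] 0#
      π^P*≈0 = trunc-*ʳ-0 (π ^ P)

      1+x-1≈x : ∀ x → 1# + x - 1# ≈ x
      1+x-1≈x x = trans (+-congʳ (+-comm 1# x)) (trans (+-assoc x 1# (- 1#)) (trans (+-congˡ (-‿inverseʳ 1#)) (+-identityʳ x)))

      ρe≈π^P : ρ * e ≈ π ^ P * 1#
      ρe≈π^P = rep-≈⇒ (rep-* (rep-fromR ρ) (rep-self ρ⁻¹))
        (rep-index (ℕ.+-identityʳ P) (rep-raise P (rep-fromR 1#))) ρ-inverse

      -- If the valuation of ρ exceeded P, then ρ e would vanish modulo π^(P+1), against ρ e = π^P.
      inBall : ∀ {x} (x≈0 : x ≈[ 1 ] 0#) → series (unit (π^P*≈0 x≈0)) ∈B[ 1# , ρ ]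
      inBall {x} x≈0 k ρ≥k i i<k with i ℤ.<? + P
      ... | yes i<P = rep-v⇐ P (rep-sub (rep-fromR _) (rep-fromR 1#))
        (trunc-trans (trunc-≈ (1+x-1≈x _)) (coarsen (ℕ.≤-reflexive (ℕ.+-identityʳ P))
          (trunc-trans (trunc-* (π^≈0 P) trunc-refl) (trunc-≈ (zeroˡ x))))) i i<P
      ... | no i≮P = contradiction
        (F.trans (F.sym (F.reflexive (𝟘-at P))) (F.trans (F.sym (below ρe≈0 P P<1+P))
          (F.trans (at ρe≈π^P P) (subst (λ t → (π ^ P * 1#) t F.≈ F.1#) (ℕ.+-identityʳ P) (π^*-at P 1# 0))))) F.0≉1
        where
        P<1+P : P ℕ.< suc P ℕ.+ 0
        P<1+P = ℕ.m≤m+n (suc P) 0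
        ρ≈0 : ρ ≈[ suc P ℕ.+ 0 ] 0#
        ρ≈0 = rep-v⇒ (suc P) (rep-fromR ρ) λ j j<1+P → ρ≥k j
          (ℤ.≤-<-trans (ℤ.≤-trans (ℤ.i<j⇒i≤pred[j] j<1+P) (ℤ.≮⇒≥ i≮P)) i<k)
        ρe≈0 : ρ * e ≈[ suc P ℕ.+ 0 ] 0#
        ρe≈0 = trunc-trans (trunc-* ρ≈0 trunc-refl) (trunc-≈ (zeroˡ e))

    local-expansion : ∀ {x} (x≈0 : x ≈[ 1 ] 0#) → π ^ m * g (π^P*≈0 x≈0) ≈ ev b x
    local-expansion {x} x≈0 = sym (trans (ev-scale e numerator x≈0)
      (hasSum⇒ev {b = numerator} (trunc-*ʳ-0 e x≈0) (λ n → rep-index (ℕ.+-identityʳ m)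
          (rep-cong (*-comm _ _) (rep-* (numerator-rep n) (rep-^ n quotient))))
        (rep-index (ℕ.+-identityʳ m) (rep-raise m (g-rep (π^P*≈0 x≈0))))
        (expansion (unit (π^P*≈0 x≈0)) (inBall x≈0))))
      where
      quotient : Rep 0 ((fromU (unit (π^P*≈0 x≈0)) 𝕂.- fromR 1#) 𝕂.* ρ⁻¹) (e * x)
      quotient = rep-lower P (rep-index (≡.sym (ℕ.+-identityʳ P)) (rep-cong
        (trans (*-congʳ (1+x-1≈x (π ^ P * x))) (solve 3 (λ P x e → (P :* x) :* e := P :* (e :* x)) refl (π ^ P) x e))
        (rep-* (rep-sub (rep-fromR _) (rep-fromR 1#)) (rep-self ρ⁻¹))))

    private
      -- The factor with (π^P x)ᵖ = π^P (s xᵖ): the p-th power of u lies in the same scaled ball,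
      -- with s xᵖ in place of x.
      s = (π ^ P) ^ p′

      ^p-suc : ∀ r → r ^ p ≈ r * r ^ p′
      ^p-suc r = ^-congʳ r p≡1+p′

      -- f(u)ᵖ = f(uᵖ) for u = 1 + πᴾ x, expanded on both sides.
      frobenius-expansion : ∀ {x} → x ≈[ 1 ] 0# → ev (λ n → b n ^ p) (x ^ p) ≈ ev (λ n → (π ^ m) ^ p′ * (s ^ n * b n)) (x ^ p)
      frobenius-expansion {x} x≈0 = begin
        ev (λ n → b n ^ p) (x ^ p)                        ≈⟨ ev-frobenius b x≈0 ⟨
        ev b x ^ p                                        ≈⟨ ^-congˡ p (local-expansion x≈0) ⟨
        (π ^ m * g z≈0) ^ p                               ≈⟨ ^-distrib-* (π ^ m) _ p ⟩
        (π ^ m) ^ p * g z≈0 ^ p                           ≈⟨ *-cong (^p-suc (π ^ m)) (trans (^-congʳ _ (≡.sym (ℕ.*-identityʳ p))) (g-frobenius^ 1 z≈0 z^p≈0)) ⟩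
        π ^ m * (π ^ m) ^ p′ * g z^p≈0                    ≈⟨ *-congˡ (g-cong z^p≈0 (π^P*≈0 sx^p≈0) z^p) ⟩
        π ^ m * (π ^ m) ^ p′ * g (π^P*≈0 sx^p≈0)          ≈⟨ solve 3 (λ a b c → a :* b :* c := b :* (a :* c)) refl _ _ _ ⟩
        (π ^ m) ^ p′ * (π ^ m * g (π^P*≈0 sx^p≈0))        ≈⟨ *-congˡ (local-expansion sx^p≈0) ⟩
        (π ^ m) ^ p′ * ev b (s * x ^ p)                   ≈⟨ *-congˡ (ev-scale s b (^p-≈0 x≈0)) ⟨
        (π ^ m) ^ p′ * ev (λ n → s ^ n * b n) (x ^ p)     ≈⟨ ev-*ˡ _ _ (^p-≈0 x≈0) ⟨
        ev (λ n → (π ^ m) ^ p′ * (s ^ n * b n)) (x ^ p)   ∎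
        where
        open SetoidReasoning setoid
        z = π ^ P * x
        z≈0 = π^P*≈0 x≈0
        sx^p≈0 : s * x ^ p ≈[ 1 ] 0#
        sx^p≈0 = trunc-*ʳ-0 s (^p-≈0 x≈0)
        z^p : z ^ (p ℕ.^ 1) ≈ π ^ P * (s * x ^ p)
        z^p = trans (^-congʳ z (ℕ.*-identityʳ p)) (trans (^-distrib-* (π ^ P) x p) (trans (*-congʳ (^p-suc (π ^ P))) (*-assoc _ _ _)))
        z^p≈0 : z ^ (p ℕ.^ 1) ≈[ 1 ] 0#
        z^p≈0 = trunc-trans (trunc-≈ z^p) (π^P*≈0 sx^p≈0)

      -- Comparison of the coefficients of `frobenius-expansion`, with (π^m)^(p-1) sⁿ collected into
      -- a single power of π.
      b-frobenius : ∀ n → b n ^ p ≈ π ^ (p′ ℕ.* (m ℕ.+ P ℕ.* n)) * b n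
      b-frobenius n = begin
        b n ^ p                                          ≈⟨ ev-identity {λ n → b n ^ p} {λ n → (π ^ m) ^ p′ * (s ^ n * b n)} points n ⟩
        (π ^ m) ^ p′ * (s ^ n * b n)                     ≈⟨ *-assoc _ _ _ ⟨
        (π ^ m) ^ p′ * s ^ n * b n                       ≈⟨ *-congʳ (*-cong (^-assocʳ π m p′) (trans (^-congˡ n (^-assocʳ π P p′)) (^-assocʳ π (P ℕ.* p′) n))) ⟩
        π ^ (m ℕ.* p′) * π ^ (P ℕ.* p′ ℕ.* n) * b n      ≈⟨ *-congʳ (^-homo-* π (m ℕ.* p′) (P ℕ.* p′ ℕ.* n)) ⟨
        π ^ (m ℕ.* p′ ℕ.+ P ℕ.* p′ ℕ.* n) * b n          ≈⟨ *-congʳ (^-congʳ π (mp+Ppn≡p[m+Pn] m p′ P n)) ⟩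
        π ^ (p′ ℕ.* (m ℕ.+ P ℕ.* n)) * b n               ∎
        where
        open SetoidReasoning setoid
        points : ∀ j → ∃[ i ] j ℕ.≤ i × ev (λ n → b n ^ p) (π ^ i) ≈ ev (λ n → (π ^ m) ^ p′ * (s ^ n * b n)) (π ^ i)
        points j = suc j ℕ.* p , ℕ.≤-trans (ℕ.n≤1+n j) (ℕ.m≤m*n (suc j) p) ,
          trans (ev-cong (λ _ → refl) (sym (^-assocʳ π (suc j) p)))
            (trans (frobenius-expansion (coarsen (s≤s z≤n) (π^≈0 (suc j)))) (ev-cong (λ _ → refl) (^-assocʳ π (suc j) p)))

    -- The constant aₙ with bₙ = π^(m+Pn) aₙ, thus the coefficient of the unscaled variable in the
    -- expansion of f(1 + x).
    germ : R
    germ n = b n (m ℕ.+ P ℕ.* n)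

    germ-fixed : ∀ n → germ n F.^ p F.≈ germ n
    germ-fixed n = coefficient-fixed (m ℕ.+ P ℕ.* n) (b-frobenius n)

    g-local : ∀ {x} (x≈0 : x ≈[ 1 ] 0#) → g (π^P*≈0 x≈0) ≈ germ ⟨ π ^ P * x ⟩
    g-local {x} x≈0 = π^-cancel m (begin
      π ^ m * g (π^P*≈0 x≈0)                                  ≈⟨ local-expansion x≈0 ⟩
      ev b x                                                  ≈⟨ ev-cong coefficient refl ⟩
      ev (λ n → π ^ m * ((π ^ P) ^ n * const (germ n))) x     ≈⟨ ev-*ˡ _ _ x≈0 ⟩
      π ^ m * ev (λ n → (π ^ P) ^ n * const (germ n)) x       ≈⟨ *-congˡ (ev-scale (π ^ P) (const ∘ germ) x≈0) ⟩
      π ^ m * germ ⟨ π ^ P * x ⟩                              ∎)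
      where
      open SetoidReasoning setoid
      coefficient : ∀ n → b n ≈ π ^ m * ((π ^ P) ^ n * const (germ n))
      coefficient n = trans (monomial (m ℕ.+ P ℕ.* n) (b-frobenius n))
        (trans (*-congʳ (trans (^-homo-* π m (P ℕ.* n)) (*-congˡ (sym (^-assocʳ π P n))))) (*-assoc _ _ _))

    germ-frobenius^ : ∀ k {x} → x ≈[ 1 ] 0# → germ ⟨ x ⟩ ^ (p ℕ.^ k) ≈ germ ⟨ x ^ (p ℕ.^ k) ⟩
    germ-frobenius^ zero    {x} x≈0 = trans (*-identityʳ _) (⟨⟩-cong refl (sym (*-identityʳ x)))
    germ-frobenius^ (suc k) {x} x≈0 = trans (sym (^-assocʳ _ p (p ℕ.^ k))) (trans (^-congˡ (p ℕ.^ k) (⟨⟩-frobenius germ-fixed x≈0))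
      (trans (germ-frobenius^ k (^p-≈0 x≈0)) (⟨⟩-cong refl (^-assocʳ x p (p ℕ.^ k)))))

    -- x^(p^k) lies in the small ball, and Frobenius is injective.
    g-global : ∀ {x} (x≈0 : x ≈[ 1 ] 0#) → g x≈0 ≈ germ ⟨ x ⟩
    g-global {x} x≈0 = frobenius^-injective k (begin
      g x≈0 ^ (p ℕ.^ k)           ≈⟨ g-frobenius^ k x≈0 (coarsen (s≤s z≤n) w≈0) ⟩
      g (coarsen (s≤s z≤n) w≈0)   ≈⟨ g-cong _ (π^P*≈0 t≈0) w≈π^Pt ⟩
      g (π^P*≈0 t≈0)              ≈⟨ g-local t≈0 ⟩
      germ ⟨ π ^ P * t ⟩          ≈⟨ ⟨⟩-cong refl w≈π^Pt ⟨
      germ ⟨ w ⟩                  ≈⟨ germ-frobenius^ k x≈0 ⟨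
      germ ⟨ x ⟩ ^ (p ℕ.^ k)      ∎)
      where
      open SetoidReasoning setoid
      -- p^(P+1) > P + 1, so π^(P+1) divides w; after division by π^P the quotient t still has no
      -- constant term.
      k = suc P
      w = x ^ (p ℕ.^ k)
      w≈0 : w ≈[ suc P ] 0#
      w≈0 = coarsen (ℕ.<⇒≤ (k<p^k k)) (trunc-^-0 (p ℕ.^ k) x≈0)
      t = drop P w
      t≈0 : t ≈[ 1 ] 0#
      t≈0 = trunc-1 (F.trans (below w≈0 (P ℕ.+ 0) (s≤s (ℕ.≤-reflexive (ℕ.+-identityʳ P)))) (F.reflexive (≡.trans (𝟘-at (P ℕ.+ 0)) (≡.sym (𝟘-at 0)))))
      w≈π^Pt : w ≈ π ^ P * t
      w≈π^Pt = factor (coarsen (ℕ.n≤1+n P) w≈0)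

    germ-character : IsCharacter germ
    germ-character = record
      { normalised     = F.trans (F.sym (at (trans (ev-horner (const ∘ germ) trunc-refl) (trans (+-congˡ (zeroˡ _)) (+-identityʳ _))) 0))
                           (at (trans (sym (g-global trunc-refl)) g-0) 0)
      ; multiplicative = λ x≈0 y≈0 → trans (*-cong (sym (g-global x≈0)) (sym (g-global y≈0))) (trans (g-* x≈0 y≈0) (g-global _))
      }

    opaque

      log : ℤₚ p
      log = -ₚ cofactor (germ , germ-character)

      to≈^log : ∀ u → to u ≈ᵁ u ^ᵁ log
      to≈^log u = ≈⇒≈ᵁ {to u} {u ^ᵁ log} (begin
        series (to u)                       ≈⟨ g-to x≈0 u (1+[u-1]≈u (series u)) ⟨
        g x≈0                               ≈⟨ g-global x≈0 ⟩
        germ ⟨ series u - 1# ⟩              ≈⟨ ⟨⟩-cong (character-power (germ , germ-character)) refl ⟩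
        ((1# + π) ^ₚ log) ⟨ series u - 1# ⟩ ≈⟨ [1+π]^ₚ-⟨⟩ log x≈0 ⟩
        (1# + (series u - 1#)) ^ₚ log       ≈⟨ ^ₚ-congˡ log (1+[u-1]≈u (series u)) ⟩
        series u ^ₚ log                     ∎)
        where
        open SetoidReasoning setoid
        x≈0 : series u - 1# ≈[ 1 ] 0#
        x≈0 = unit-decompose (series≈1 u)

-- The group Λ and the isomorphism with ℤₚ.

module PointwiseMultiplication {c ℓ : Level} {p : ℕ} (p-prime : Prime p) (𝔽 : FiniteField c ℓ p) where

  open Truncation p-prime 𝔽
  open Evaluation p-prime 𝔽 using (π≈0)
  open Powers p-prime 𝔽
  open PowerMaps p-prime 𝔽
  open LocallyAnalyticMaps p-prime 𝔽
  open OneUnits p-prime 𝔽 using (U; oneUnit; series; _·_; Λ; _≈ᴸ_; PointwiseGroup)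

  private
    value : Λ → U → R
    value f u = series (Λ.to f u)

  ≈ᴸ⇒ : ∀ {f g} → f ≈ᴸ g → ∀ u → value f u ≈ value g u
  ≈ᴸ⇒ {f} {g} e u = ≈ᵁ⇒≈ {Λ.to f u} {Λ.to g u} (e u)

  ⇒≈ᴸ : ∀ {f g} → (∀ u → value f u ≈ value g u) → f ≈ᴸ g
  ⇒≈ᴸ {f} {g} e u = ≈⇒≈ᵁ {Λ.to f u} {Λ.to g u} (e u)

  value-log : ∀ f u → value f u ≈ series u ^ₚ log f
  value-log f = ≈ᴸ⇒ {f} {pow (log f)} (to≈^log f)

  opaque

    _∙_ : Λ → Λ → Λ
    f ∙ g = pow (log f +ₚ log g)

    _⁻¹ : Λ → Λ
    f ⁻¹ = pow (-ₚ log f)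

    ∙-value : ∀ f g u → value (f ∙ g) u ≈ value f u * value g u
    ∙-value f g u = trans (^ₚ-+ (log f) (log g) (series≈1 u)) (*-cong (sym (value-log f u)) (sym (value-log g u)))

    ⁻¹-value : ∀ f u → value f u * value (f ⁻¹) u ≈ 1#
    ⁻¹-value f u = trans (*-congʳ (value-log f u)) (^ₚ-inverse (log f) (series≈1 u))

  ⁻¹-unique : ∀ {a b b′} → a * b ≈ 1# → a * b′ ≈ 1# → b ≈ b′
  ⁻¹-unique {a} {b} {b′} ab≈1 ab′≈1 = begin
    b               ≈⟨ *-identityʳ b ⟨
    b * 1#          ≈⟨ *-congˡ ab′≈1 ⟨
    b * (a * b′)    ≈⟨ solve 3 (λ a b c → b :* (a :* c) := (a :* b) :* c) refl a b b′ ⟩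
    a * b * b′      ≈⟨ *-congʳ ab≈1 ⟩
    1# * b′         ≈⟨ *-identityˡ b′ ⟩
    b′              ∎
    where open SetoidReasoning setoid

  ε-value : ∀ u → value (pow 0ₚ) u ≈ 1#
  ε-value u = ^ₚ-0 (series≈1 u)

  pointwiseGroup : PointwiseGroup
  pointwiseGroup = record
    { _∙_       = _∙_
    ; ε         = pow 0ₚ
    ; _⁻¹       = _⁻¹
    ; isGroup   = record
      { isMonoid = record
        { isSemigroup = record
          { isMagma = record
            { isEquivalence = record
              { refl  = λ {f} → ⇒≈ᴸ {f} {f} λ _ → refl
              ; sym   = λ {f} {g} e → ⇒≈ᴸ {g} {f} λ u → sym (≈ᴸ⇒ {f} {g} e u)
              ; trans = λ {f} {g} {h} d e → ⇒≈ᴸ {f} {h} λ u → trans (≈ᴸ⇒ {f} {g} d u) (≈ᴸ⇒ {g} {h} e u)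
              }
            ; ∙-cong = λ {f} {f′} {g} {g′} d e → ⇒≈ᴸ {f ∙ g} {f′ ∙ g′} λ u →
                trans (∙-value f g u) (trans (*-cong (≈ᴸ⇒ {f} {f′} d u) (≈ᴸ⇒ {g} {g′} e u)) (sym (∙-value f′ g′ u)))
            }
          ; assoc = λ f g h → ⇒≈ᴸ {(f ∙ g) ∙ h} {f ∙ (g ∙ h)} λ u →
              trans (∙-value (f ∙ g) h u) (trans (*-congʳ (∙-value f g u)) (trans (*-assoc _ _ _)
                (sym (trans (∙-value f (g ∙ h) u) (*-congˡ (∙-value g h u))))))
          }
        ; identity =
            (λ f → ⇒≈ᴸ {pow 0ₚ ∙ f} {f} λ u → trans (∙-value (pow 0ₚ) f u) (trans (*-congʳ (ε-value u)) (*-identityˡ _))) ,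
            (λ f → ⇒≈ᴸ {f ∙ pow 0ₚ} {f} λ u → trans (∙-value f (pow 0ₚ) u) (trans (*-congˡ (ε-value u)) (*-identityʳ _)))
        }
      ; inverse =
          (λ f → ⇒≈ᴸ {(f ⁻¹) ∙ f} {pow 0ₚ} λ u → trans (∙-value (f ⁻¹) f u) (trans (*-comm _ _) (trans (⁻¹-value f u) (sym (ε-value u))))) ,
          (λ f → ⇒≈ᴸ {f ∙ (f ⁻¹)} {pow 0ₚ} λ u → trans (∙-value f (f ⁻¹) u) (trans (⁻¹-value f u) (sym (ε-value u))))
      ; ⁻¹-cong = λ {f} {g} e → ⇒≈ᴸ {f ⁻¹} {g ⁻¹} λ u → ⁻¹-unique (⁻¹-value f u) (trans (*-congʳ (≈ᴸ⇒ {f} {g} e u)) (⁻¹-value g u))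
      }
    ; pointwise = λ f g u → ≈⇒≈ᵁ {Λ.to (f ∙ g) u} {Λ.to f u · Λ.to g u} (trans (∙-value f g u) (sym (·-series (Λ.to f u) (Λ.to g u))))
    }

  pow-cong : ∀ {y z} → y ≈ₚ z → pow y ≈ᴸ pow z
  pow-cong {y} {z} y≈z = ⇒≈ᴸ {pow y} {pow z} λ u → ^ₚ-congʳ (series≈1 u) y≈z

  -- The value at the single 1-unit 1 + π determines the exponent.
  pow-injective : ∀ {y z} → pow y ≈ᴸ pow z → y ≈ₚ z
  pow-injective {y} {z} e = [1+π]^ₚ-injective y z (≈ᴸ⇒ {pow y} {pow z} e (oneUnit (1# + π) (below (1+x≈1 π≈0) 0 (s≤s z≤n))))

  pow-isGroupIsomorphism : GroupMorphisms.IsGroupIsomorphism (ℤₚ-rawGroup p) (PointwiseGroup.rawGroup pointwiseGroup) pow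
  pow-isGroupIsomorphism = record
    { isGroupMonomorphism = record
      { isGroupHomomorphism = record
        { isMonoidHomomorphism = record
          { isMagmaHomomorphism = record
            { isRelHomomorphism = record { cong = pow-cong }
            ; homo = λ y z → ⇒≈ᴸ {pow (y +ₚ z)} {pow y ∙ pow z} λ u →
                trans (^ₚ-+ y z (series≈1 u)) (sym (∙-value (pow y) (pow z) u))
            }
          ; ε-homo = λ _ _ → F.refl
          }
        ; ⁻¹-homo = λ y → ⇒≈ᴸ {pow (-ₚ y)} {pow y ⁻¹} λ u → ⁻¹-unique (^ₚ-inverse y (series≈1 u)) (⁻¹-value (pow y) u)
        }
      ; injective = pow-injective
      }
    ; surjective = λ f → log f , λ {y} y≈log → ⇒≈ᴸ {pow y} {f} λ u →
        trans (^ₚ-congʳ (series≈1 u) y≈log) (sym (value-log f u))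
    }

theorem1p1 : {c ℓ : Level} (p : ℕ) (p-prime : Prime p) (𝔽 : FiniteField c ℓ p) →
    let open OneUnits p-prime 𝔽 in
    Σ[ G ∈ PointwiseGroup ] Σ[ pow ∈ (ℤₚ p → Λ) ]
    (∀ y u → IsPower u y (Λ.to (pow y) u)) ×
    GroupMorphisms.IsGroupIsomorphism (ℤₚ-rawGroup p) (PointwiseGroup.rawGroup G) pow
theorem1p1 p p-prime 𝔽 = pointwiseGroup , pow , isPower , pow-isGroupIsomorphism
  where
  open PowerMaps p-prime 𝔽
  open PointwiseMultiplication p-prime 𝔽
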